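{- For every positive integer $k$ there exist systems of constraints $F$ over arbitrarily large numbers $n$ of variables such that: the incidence treewidth of $F$ is $O(k)$; every d-SDNNF circuit computing $F$ has size $(n/k)^{\Omega(k)}$; and every constraint $c$ of $F$ is $O(nk)$-slim for OBDDs, i.e., for every total order $\pi$ of $\mathit{var}(c)$ there is a complete $\pi$-OBDD of width $O(nk)$ computing $c$.
   Context: A system of constraints is a finite conjunction of Boolean functions (constraints) each on a finite set of Boolean variables. Its incidence graph has the constraints and variables as vertices, with an edge between constraint $c$ and variable $x$ iff $x\in\mathit{var}(c)$; the incidence treewidth is the treewidth of this graph. A d-SDNNF circuit is a Boolean circuit with literal inputs and binary $\land$/$\lor$ gates, together with a vtree $\tau$ (rooted binary tree with leaves in bijection with the variables) and a map $\lambda$ from gates to vtree nodes such that $\mathit{var}(D_g)\subseteq\mathit{var}(\lambda(g))$ for all gates $g$ ($D_g$ the subcircuit at $g$, $\mathit{var}(t)$ the variables at leaves below $t$), $\lambda(g)=\lambda(g_1)=\lambda(g_2)$ for every $\lor$-gate $g=g_1\lor g_2$, for every $\land$-gate $g=g_1\land g_2$ the node $\lambda(g)$ has children $t_1,t_2$ with $\lambda(g_i)$ below $t_i$, and for every $\lor$-gate $g_1\lor g_2$ no assignment satisfies both $D_{g_1}$ and $D_{g_2}$. Size is the number of gates and wires. A $\pi$-OBDD is a binary decision diagram (DAG with one source, sinks $0$ and $1$, internal decision nodes labelled by variables with a $0$-child and a $1$-child) in which variables appear at most once and in an order consistent with $\pi$ along every root-to-sink path; it is complete if every such path contains all variables.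 Its width is the maximum number of nodes labelled by the same variable. -}

module Defs where

open import Data.Nat using (ℕ; zero; suc; _+_; _≤_)
open import Data.Bool using (Bool; true; false; not; _∧_; _∨_; if_then_else_)
open import Data.Fin using (Fin; zero; suc; _≟_)
open import Data.Fin.Subset using (Subset) renaming (_∈_ to _∈ₛ_)
open import Data.List using (List; []; _∷_; length; lookup; map; _++_; allFin)
open import Data.List.Membership.Propositional using (_∈_)
open import Data.List.Relation.Unary.Unique.Propositional using (Unique)
open import Data.List.Relation.Binary.Sublist.Propositional using (_⊆_)
open import Data.Maybe using (Maybe; just; nothing; maybe)
open import Data.Product using (Σ; ∃; _×_; _,_)
open import Data.Sum using (_⊎_; inj₁; inj₂)
open import Data.Empty using (⊥)
open import Data.Unit using (⊤)
open import Relation.Nullary using (¬_; does)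
open import Relation.Binary.PropositionalEquality using (_≡_)

Assignment : ℕ → Set
Assignment n = Fin n → Bool

record Constraint (n : ℕ) : Set where
  field
    scope : Subset n
    rel   : Assignment n → Bool
    local : ∀ (a b : Assignment n) → (∀ x → x ∈ₛ scope → a x ≡ b x) → rel a ≡ rel b
open Constraint public

record System (n : ℕ) : Set where
  field
    m   : ℕ
    con : Fin m → Constraint n
open System public

allTrue : List Bool → Bool
allTrue [] = true
allTrue (b ∷ bs) = b ∧ allTrue bs

sat : ∀ {n} → System n → Assignment n → Bool
sat F a = allTrue (map (λ i → rel (con F i) a) (allFin (m F)))

IVertex : ∀ {n} → System n → Set
IVertex {n} F = Fin (m F) ⊎ Fin n

IEdge : ∀ {n} (F : System n) → IVertex F → IVertex F → Set
IEdge F (inj₁ i) (inj₂ x) = x ∈ₛ scope (con F i)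
IEdge F (inj₂ x) (inj₁ i) = x ∈ₛ scope (con F i)
IEdge F _ _ = ⊥

data RTree (A : Set) : Set where
  node : A → List (RTree A) → RTree A

rootLabel : ∀ {A} → RTree A → A
rootLabel (node a _) = a

mutual
  data SomeNode {A : Set} (P : A → Set) : RTree A → Set where
    here  : ∀ {a ts} → P a → SomeNode P (node a ts)
    there : ∀ {a ts} → SomeNodes P ts → SomeNode P (node a ts)

  data SomeNodes {A : Set} (P : A → Set) : List (RTree A) → Set where
    hd : ∀ {t ts} → SomeNode P t → SomeNodes P (t ∷ ts)
    tl : ∀ {t ts} → SomeNodes P ts → SomeNodes P (t ∷ ts)

mutual
  AllNodes : ∀ {A : Set} → (A → Set) → RTree A → Set
  AllNodes P (node a ts) = P a × AllNodesL P ts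

  AllNodesL : ∀ {A : Set} → (A → Set) → List (RTree A) → Set
  AllNodesL P [] = ⊤
  AllNodesL P (t ∷ ts) = AllNodes P t × AllNodesL P ts

-- `Conn v t`: the set of nodes of t whose bag contains v induces a connected
-- subtree (possibly empty).  Recursive characterisation: the restriction to
-- each child subtree is connected, and
--  * if v is in the root bag, every child subtree containing v has v in its root bag;
--  * otherwise, at most one child subtree contains v.
mutual
  Conn : ∀ {V : Set} → V → RTree (List V) → Set
  Conn v (node b ts) =
    ConnL v ts
    × (v ∈ b → ∀ i → SomeNode (v ∈_) (lookup ts i) → v ∈ rootLabel (lookup ts i))
    × (¬ (v ∈ b) → ∀ i j → SomeNode (v ∈_) (lookup ts i) → SomeNode (v ∈_) (lookup ts j) → i ≡ j)

  ConnL : ∀ {V : Set} → V → List (RTree (List V)) → Set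
  ConnL v [] = ⊤
  ConnL v (t ∷ ts) = Conn v t × ConnL v ts

record TreeDecomposition {n : ℕ} (F : System n) (w : ℕ) : Set where
  field
    tree      : RTree (List (IVertex F))
    coverV    : ∀ v → SomeNode (v ∈_) tree
    coverE    : ∀ u v → IEdge F u v → SomeNode (λ b → u ∈ b × v ∈ b) tree
    connected : ∀ v → Conn v tree
    bagSize   : AllNodes (λ b → length b ≤ suc w) tree

IncidenceTreewidth≤ : ∀ {n} → System n → ℕ → Set
IncidenceTreewidth≤ F w = TreeDecomposition F w

-- Boolean circuits (DAGs, gates listed newest-first; a gate only refers to
-- gates added before it, i.e. later in the list)

data Gate (n g : ℕ) : Set where
  const : Bool → Gate n g
  lit   : Fin n → Bool → Gate n g      -- lit x true = x ; lit x false = ¬x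
  and   : Fin g → Fin g → Gate n g
  or    : Fin g → Fin g → Gate n g

mapGate : ∀ {n g h} → (Fin g → Fin h) → Gate n g → Gate n h
mapGate f (const b) = const b
mapGate f (lit x b) = lit x b
mapGate f (and i j) = and (f i) (f j)
mapGate f (or i j)  = or (f i) (f j)

data Circ (n : ℕ) : ℕ → Set where
  []  : Circ n 0
  _∷_ : ∀ {g} → Gate n g → Circ n g → Circ n (suc g)

litVal : ∀ {n} → Fin n → Bool → Assignment n → Bool
litVal x true a = a x
litVal x false a = not (a x)

evalGate : ∀ {n g} → Gate n g → (Fin g → Bool) → Assignment n → Bool
evalGate (const b) f a = b
evalGate (lit x b) f a = litVal x b a
evalGate (and i j) f a = f i ∧ f j
evalGate (or i j)  f a = f i ∨ f j

eval : ∀ {n g} → Circ n g → Assignment n → Fin g → Bool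
eval (k ∷ C) a zero    = evalGate k (eval C a) a
eval (k ∷ C) a (suc i) = eval C a i

-- the gate at a position, with children given as global positions
gateAt : ∀ {n g} → Circ n g → Fin g → Gate n g
gateAt (k ∷ C) zero    = mapGate suc k
gateAt (k ∷ C) (suc i) = mapGate suc (gateAt C i)

occ : ∀ {n g} → Circ n g → Fin n → Fin g → Set
occ (const b ∷ C) x zero = ⊥
occ (lit y b ∷ C) x zero = y ≡ x
occ (and i j ∷ C) x zero = occ C x i ⊎ occ C x j
occ (or i j ∷ C)  x zero = occ C x i ⊎ occ C x j
occ (k ∷ C) x (suc i) = occ C x i

arity : ∀ {n g} → Gate n g → ℕ
arity (const _) = 0
arity (lit _ _) = 0
arity (and _ _) = 2
arity (or _ _)  = 2

size : ∀ {n g} → Circ n g → ℕ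
size [] = 0
size (k ∷ C) = suc (arity k + size C)

data VTree (n : ℕ) : Set where
  leaf : Fin n → VTree n
  node : VTree n → VTree n → VTree n

leaves : ∀ {n} → VTree n → List (Fin n)
leaves (leaf x) = x ∷ []
leaves (node l r) = leaves l ++ leaves r

data Dir : Set where
  L R : Dir

-- nodes of a vtree are addressed by paths from the root
subAt : ∀ {n} → VTree n → List Dir → Maybe (VTree n)
subAt t [] = just t
subAt (leaf x) (_ ∷ p) = nothing
subAt (node l r) (L ∷ p) = subAt l p
subAt (node l r) (R ∷ p) = subAt r p

varsAt : ∀ {n} → VTree n → List Dir → List (Fin n)
varsAt t p = maybe leaves [] (subAt t p)

GateOK : ∀ {n G} → Circ n G → (Fin G → List Dir) → Fin G → Gate n G → Set
GateOK C lab g (const _) = ⊤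
GateOK C lab g (lit _ _) = ⊤
GateOK C lab g (and i j) =
  (∃ λ r → lab i ≡ lab g ++ (L ∷ r)) × (∃ λ r → lab j ≡ lab g ++ (R ∷ r))
GateOK C lab g (or i j) =
  lab g ≡ lab i × lab g ≡ lab j
  × (∀ a → eval C a i ≡ true → eval C a j ≡ false)

record DSDNNF (n G : ℕ) : Set where
  field
    circ     : Circ n (suc G)
    vtree    : VTree n
    leavesAll  : ∀ x → x ∈ leaves vtree
    leavesUniq : Unique (leaves vtree)
    lab      : Fin (suc G) → List Dir
    labValid : ∀ g → ∃ λ s → subAt vtree (lab g) ≡ just s
    labVars  : ∀ g x → occ circ x g → x ∈ varsAt vtree (lab g)
    gatesOK  : ∀ g → GateOK circ lab g (gateAt circ g)
open DSDNNF public

output : ∀ {n G} → DSDNNF n G → Assignment n → Bool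
output D a = eval (circ D) a zero

dsdnnfSize : ∀ {n G} → DSDNNF n G → ℕ
dsdnnfSize D = size (circ D)

DComputes : ∀ {n G} → DSDNNF n G → System n → Set
DComputes D F = ∀ a → output D a ≡ sat F a

-- OBDDs (decision nodes listed newest-first; children are earlier nodes or sinks)

Child : ℕ → Set
Child g = Fin g ⊎ Bool     -- inj₂ b = sink b

data DNode (n g : ℕ) : Set where
  dec : Fin n → Child g → Child g → DNode n g     -- variable, 0-child, 1-child

data BDD (n : ℕ) : ℕ → Set where
  []  : BDD n 0
  _∷_ : ∀ {g} → DNode n g → BDD n g → BDD n (suc g)

record OBDD (n : ℕ) : Set where
  field
    g     : ℕ
    nodes : BDD n g
    root  : Child g
open OBDD public

mutual
  evalN : ∀ {n g} → BDD n g → Assignment n → Fin g → Bool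
  evalN (dec x c0 c1 ∷ B) a zero = if a x then evalC B a c1 else evalC B a c0
  evalN (k ∷ B) a (suc i) = evalN B a i

  evalC : ∀ {n g} → BDD n g → Assignment n → Child g → Bool
  evalC B a (inj₁ i) = evalN B a i
  evalC B a (inj₂ b) = b

mutual
  pathsN : ∀ {n g} → BDD n g → Fin g → List (List (Fin n))
  pathsN (dec x c0 c1 ∷ B) zero = map (x ∷_) (pathsC B c0 ++ pathsC B c1)
  pathsN (k ∷ B) (suc i) = pathsN B i

  pathsC : ∀ {n g} → BDD n g → Child g → List (List (Fin n))
  pathsC B (inj₁ i) = pathsN B i
  pathsC B (inj₂ b) = [] ∷ []

labelCount : ∀ {n g} → BDD n g → Fin n → ℕ
labelCount [] x = 0
labelCount (dec y _ _ ∷ B) x = (if does (y ≟ x) then 1 else 0) + labelCount B x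

obddEval : ∀ {n} → OBDD n → Assignment n → Bool
obddEval B a = evalC (nodes B) a (root B)

WidthAtMost : ∀ {n} → OBDD n → ℕ → Set
WidthAtMost B w = ∀ x → labelCount (nodes B) x ≤ w

IsOrderOf : ∀ {n} → List (Fin n) → Subset n → Set
IsOrderOf π vs = Unique π × (∀ x → x ∈ π → x ∈ₛ vs) × (∀ x → x ∈ₛ vs → x ∈ π)

-- complete π-OBDD: every root-to-sink path reads variables in π-order,
-- each at most once (sublist of the repetition-free π), and reads all of them
CompletePiOBDD : ∀ {n} → List (Fin n) → OBDD n → Set
CompletePiOBDD π B = ∀ p → p ∈ pathsC (nodes B) (root B) → (p ⊆ π) × (∀ x → x ∈ π → x ∈ p)

SlimOBDD : ∀ {n} → Constraint n → ℕ → Set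
SlimOBDD {n} c w = ∀ (π : List (Fin n)) → IsOrderOf π (scope c) →
  Σ (OBDD n) λ B → CompletePiOBDD π B × WidthAtMost B w × (∀ a → obddEval B a ≡ rel c a)

{-# OPTIONS --safe #-}

-- The variables form a K × K grid of cells of M copies each, and the constraints fix
-- all 2K row and column sums. A cardinality constraint is slim because it only has to
-- count, and a star whose bags consist of all constraints and one variable bounds the
-- treewidth. For the lower bound, a node of the vtree partitions the variables, and a
-- structured circuit yields a fooling-set bound for this partition: follow a certificate
-- of each accepted assignment down to the first gate that reads only one side; two
-- assignments ending in the same gate may be mixed. A suitable node leaves k disjoint
-- 2 × 2 minors of cells, each with a row or column whose two cells have many copies on
-- different sides. Adding y_s, −y_s, −y_s, y_s to the counts of the s-th minor preserves
-- all sums, while mixing two different vectors y violates the sum of a bichromatic line.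
-- The vectors y ∈ [0, Q)^k thus form a fooling set of size Q^k.

module Submission where

open import Defs
open import Data.Bool using (Bool; true; false; not; _∧_; _∨_; _xor_; if_then_else_)
open import Data.Bool.Properties using (∨-zeroʳ; xor-comm; xor-identityʳ)
open import Data.Empty using (⊥; ⊥-elim)
open import Data.Fin using (Fin; zero; suc; toℕ; _≟_; _↑ˡ_; _↑ʳ_; splitAt; combine; remQuot; finToFun; funToFin)
open import Data.Fin.Properties using (toℕ-injective; toℕ<n; any?; ¬∀⟶∃¬; injective⇒≤; splitAt-↑ˡ; splitAt-↑ʳ; remQuot-combine; combine-remQuot; combine-injective; combine-injectiveʳ; funToFin-finToFin)
open import Data.Fin.Subset using (Subset) renaming (_∈_ to _∈ₛ_)
open import Data.List using (List; []; _∷_; map; _++_; length; lookup; allFin; tabulate)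
import Data.List.Membership.DecPropositional as DecMembership
open import Data.List.Membership.Propositional using (_∈_; _∉_)
open import Data.List.Membership.Propositional.Properties using (∈-map⁻; ∈-++⁺ˡ; ∈-++⁺ʳ; ∈-++⁻; ∈-tabulate⁺; ∈-tabulate⁻; ∈-allFin)
open import Data.List.Membership.Propositional.Properties.WithK using (unique∧set⇒bag)
open import Data.List.Properties using (length-++; length-tabulate)
open import Data.List.Relation.Binary.BagAndSetEquality using (∼bag⇒↭)
open import Data.List.Relation.Binary.Permutation.Propositional.Properties using (map⁺)
open import Data.List.Relation.Binary.Sublist.Propositional using (_⊆_; ⊆-refl)
open import Data.List.Relation.Unary.All using () renaming (lookup to All-lookup)
open import Data.List.Relation.Unary.All.Properties using () renaming (++⁻ˡ to All-++⁻ˡ; ++⁻ʳ to All-++⁻ʳ)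
open import Data.List.Relation.Unary.AllPairs using ([]; _∷_)
open import Data.List.Relation.Unary.Any using (here; there; index)
open import Data.List.Relation.Unary.Any.Properties using (lookup-index)
open import Data.List.Relation.Unary.Unique.Propositional using (Unique)
open import Data.List.Relation.Unary.Unique.Propositional.Properties using (tabulate⁺)
open import Data.Maybe using (Maybe; just; nothing; maybe)
open import Data.Nat using (ℕ; zero; suc; _+_; _*_; _∸_; _^_; _⊓_; _≤_; _<_; z≤n; s≤s; s≤s⁻¹; _≤?_; NonZero; >-nonZero) renaming (_≟_ to _≟ℕ_)
open import Data.Nat.DivMod using (_/_; m*n/n≡m)
open import Data.Nat.ListAction using () renaming (sum to sumˡ)
open import Data.Nat.ListAction.Properties using (sum-↭)
open import Data.Nat.Properties hiding (_≟_)
open import Data.Nat.Tactic.RingSolver using (solve-∀)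
open import Data.Product using (Σ; ∃; _×_; _,_; proj₁; proj₂; map₂)
open import Data.Sum using (_⊎_; inj₁; inj₂)
open import Data.Unit using (⊤; tt)
open import Data.Vec using () renaming (tabulate to tabulateᵛ)
open import Data.Vec.Functional using (updateAt)
open import Data.Vec.Functional.Properties using (updateAt-updates; updateAt-minimal)
open import Data.Vec.Properties using (lookup∘tabulate; []=⇒lookup; lookup⇒[]=)
open import Function using (_∘_)
open import Function.Bundles using (mk⇔)
open import Relation.Binary.PropositionalEquality using (_≡_; _≢_; refl; sym; trans; cong; cong₂; subst; module ≡-Reasoning)
open import Relation.Nullary using (¬_; Dec; does; yes; no)
open import Relation.Nullary.Decidable using (dec-true; dec-false; _×-dec_; _⊎-dec_; ¬?)
open import Algebra.Properties.CommutativeMonoid.Sum +-0-commutativeMonoid using (sum; sum-cong-≗; ∑-distrib-+)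

_∈?_ : ∀ {n} (x : Fin n) xs → Dec (x ∈ xs)
_∈?_ = DecMembership._∈?_ _≟_

-- Cardinality constraints are slim

bit : Bool → ℕ
bit true = 1
bit false = 0

count : ∀ {n} → Assignment n → List (Fin n) → ℕ
count a xs = sumˡ (map (bit ∘ a) xs)

module _ {n : ℕ} where

  liftChild : ∀ w {g} → Child g → Child (w + g)
  liftChild w (inj₁ i) = inj₁ (w ↑ʳ i)
  liftChild w (inj₂ b) = inj₂ b

  -- All nodes of a layer point into the old diagram `B` and never into the layer itself, so no path
  -- meets two of them. `liftChild` skips the nodes of the layer that are already stacked.
  layer : ∀ {g} → Fin n → (w : ℕ) → (Fin w → Child g) → (Fin w → Child g) → BDD n g → BDD n (w + g)
  layer x zero    c₀ c₁ B = B
  layer x (suc w) c₀ c₁ B =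
    dec x (liftChild w (c₀ zero)) (liftChild w (c₁ zero)) ∷ layer x w (c₀ ∘ suc) (c₁ ∘ suc) B

  module _ {g} (x : Fin n) (B : BDD n g) where

    evalN-layer-old : ∀ w c₀ c₁ a i → evalN (layer x w c₀ c₁ B) a (w ↑ʳ i) ≡ evalN B a i
    evalN-layer-old zero    c₀ c₁ a i = refl
    evalN-layer-old (suc w) c₀ c₁ a i = evalN-layer-old w (c₀ ∘ suc) (c₁ ∘ suc) a i

    evalC-layer : ∀ w c₀ c₁ a c → evalC (layer x w c₀ c₁ B) a (liftChild w c) ≡ evalC B a c
    evalC-layer w c₀ c₁ a (inj₁ i) = evalN-layer-old w c₀ c₁ a i
    evalC-layer w c₀ c₁ a (inj₂ b) = refl

    evalN-layer : ∀ w c₀ c₁ a i → evalN (layer x w c₀ c₁ B) a (i ↑ˡ g) ≡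
      (if a x then evalC B a (c₁ i) else evalC B a (c₀ i))
    evalN-layer (suc w) c₀ c₁ a zero =
      cong₂ (if a x then_else_) (evalC-layer w (c₀ ∘ suc) (c₁ ∘ suc) a (c₁ zero))
        (evalC-layer w (c₀ ∘ suc) (c₁ ∘ suc) a (c₀ zero))
    evalN-layer (suc w) c₀ c₁ a (suc i) = evalN-layer w (c₀ ∘ suc) (c₁ ∘ suc) a i

    pathsN-layer-old : ∀ w c₀ c₁ i → pathsN (layer x w c₀ c₁ B) (w ↑ʳ i) ≡ pathsN B i
    pathsN-layer-old zero    c₀ c₁ i = refl
    pathsN-layer-old (suc w) c₀ c₁ i = pathsN-layer-old w (c₀ ∘ suc) (c₁ ∘ suc) i

    pathsC-layer : ∀ w c₀ c₁ c → pathsC (layer x w c₀ c₁ B) (liftChild w c) ≡ pathsC B c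
    pathsC-layer w c₀ c₁ (inj₁ i) = pathsN-layer-old w c₀ c₁ i
    pathsC-layer w c₀ c₁ (inj₂ b) = refl

    pathsN-layer : ∀ w c₀ c₁ i → pathsN (layer x w c₀ c₁ B) (i ↑ˡ g) ≡
      map (x ∷_) (pathsC B (c₀ i) ++ pathsC B (c₁ i))
    pathsN-layer (suc w) c₀ c₁ zero =
      cong₂ (λ p q → map (x ∷_) (p ++ q)) (pathsC-layer w (c₀ ∘ suc) (c₁ ∘ suc) (c₀ zero))
        (pathsC-layer w (c₀ ∘ suc) (c₁ ∘ suc) (c₁ zero))
    pathsN-layer (suc w) c₀ c₁ (suc i) = pathsN-layer w (c₀ ∘ suc) (c₁ ∘ suc) i

    labelCount-layer-≡ : ∀ w c₀ c₁ → labelCount (layer x w c₀ c₁ B) x ≡ w + labelCount B x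
    labelCount-layer-≡ zero    c₀ c₁ = refl
    labelCount-layer-≡ (suc w) c₀ c₁ rewrite dec-true (x ≟ x) refl =
      cong suc (labelCount-layer-≡ w (c₀ ∘ suc) (c₁ ∘ suc))

    labelCount-layer-≢ : ∀ w c₀ c₁ y → x ≢ y → labelCount (layer x w c₀ c₁ B) y ≡ labelCount B y
    labelCount-layer-≢ zero    c₀ c₁ y x≢y = refl
    labelCount-layer-≢ (suc w) c₀ c₁ y x≢y rewrite dec-false (x ≟ y) x≢y =
      labelCount-layer-≢ w (c₀ ∘ suc) (c₁ ∘ suc) y x≢y

module Automaton {n : ℕ} (w : ℕ) (δ : Bool → Fin w → Fin w) (accept : Fin w → Bool) where

  run : Assignment n → List (Fin n) → Fin w → Fin w
  run a []      s = s
  run a (x ∷ π) s = run a π (δ (a x) s)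

  -- One layer per variable of `π` and one node per state. No nodes are merged and no layer is
  -- skipped, so every path reads exactly `π`; `start s` is the entry for state `s`.
  record Unrolling (π : List (Fin n)) : Set where
    field
      order  : ℕ
      bdd    : BDD n order
      start  : Fin w → Child order
      eval≡  : ∀ a s → evalC bdd a (start s) ≡ accept (run a π s)
      paths≡ : ∀ s p → p ∈ pathsC bdd (start s) → p ≡ π
      absent : ∀ x → ¬ (x ∈ π) → labelCount bdd x ≡ 0
      width  : Unique π → ∀ x → labelCount bdd x ≤ w

  unroll : ∀ π → Unrolling π
  unroll [] = record
    { order  = 0
    ; bdd    = []
    ; start  = inj₂ ∘ accept
    ; eval≡  = λ _ _ → refl
    ; paths≡ = λ { _ _ (here e) → e }
    ; absent = λ _ _ → refl
    ; width  = λ _ _ → z≤n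
    }
  unroll (x ∷ π) = record
    { order  = w + order
    ; bdd    = B
    ; start  = λ s → inj₁ (s ↑ˡ order)
    ; eval≡  = eval′
    ; paths≡ = paths′
    ; absent = λ y y∉ → trans (labelCount-layer-≢ x bdd w _ _ y (λ e → y∉ (here (sym e))))
                              (absent y (y∉ ∘ there))
    ; width  = width′
    }
    where
    open Unrolling (unroll π)
    B = layer x w (start ∘ δ false) (start ∘ δ true) bdd

    eval′ : ∀ a s → evalN B a (s ↑ˡ order) ≡ accept (run a π (δ (a x) s))
    eval′ a s rewrite evalN-layer x bdd w (start ∘ δ false) (start ∘ δ true) a s with a x
    ... | true  = eval≡ a _
    ... | false = eval≡ a _

    paths′ : ∀ s p → p ∈ pathsN B (s ↑ˡ order) → p ≡ x ∷ π
    paths′ s p p∈ with ∈-map⁻ (x ∷_) (subst (p ∈_) (pathsN-layer x bdd w _ _ s) p∈)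
    ... | q , q∈ , refl with ∈-++⁻ (pathsC bdd (start (δ false s))) q∈
    ...   | inj₁ h = cong (x ∷_) (paths≡ _ q h)
    ...   | inj₂ h = cong (x ∷_) (paths≡ _ q h)

    width′ : Unique (x ∷ π) → ∀ y → labelCount B y ≤ w
    width′ (x∉ ∷ u) y with x ≟ y
    ... | no x≢y   = subst (_≤ w) (sym (labelCount-layer-≢ x bdd w _ _ y x≢y)) (width u y)
    -- All nodes labelled `x` are in the new layer: `π` does not repeat `x`, so none lies further
    -- down.
    ... | yes refl = ≤-reflexive (trans (labelCount-layer-≡ x bdd w _ _)
                       (trans (cong (w +_) (absent x λ x∈ → All-lookup x∉ x∈ refl)) (+-identityʳ w)))

count-cong : ∀ {n} (a b : Assignment n) ys → (∀ x → x ∈ ys → a x ≡ b x) → count a ys ≡ count b ys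
count-cong a b []       e = refl
count-cong a b (y ∷ ys) e =
  cong₂ _+_ (cong bit (e y (here refl))) (count-cong a b ys λ x x∈ → e x (there x∈))

satSuc : ∀ {m} → Fin (suc m) → Fin (suc m)
satSuc {zero}  i       = i
satSuc {suc m} zero    = suc zero
satSuc {suc m} (suc i) = suc (satSuc i)

toℕ-satSuc : ∀ {m} (i : Fin (suc m)) → toℕ (satSuc i) ≡ suc (toℕ i) ⊓ m
toℕ-satSuc {zero}  zero    = refl
toℕ-satSuc {suc m} zero    = refl
toℕ-satSuc {suc m} (suc i) = cong suc (toℕ-satSuc i)

module CardinalityConstraint {n : ℕ} (xs : List (Fin n)) (T : ℕ) where

  members : Subset n
  members = tabulateᵛ λ x → does (x ∈? xs)

  ∈-members⁺ : ∀ x → x ∈ xs → x ∈ₛ members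
  ∈-members⁺ x x∈ = lookup⇒[]= x members (trans (lookup∘tabulate _ x) (dec-true (x ∈? xs) x∈))

  ∈-members⁻ : ∀ x → x ∈ₛ members → x ∈ xs
  ∈-members⁻ x x∈ with x ∈? xs
    | trans (sym (lookup∘tabulate (λ x → does (x ∈? xs)) x)) ([]=⇒lookup x∈)
  ... | yes h | _ = h
  ... | no _  | ()

  cardinality : Constraint n
  cardinality = record
    { scope = members
    ; rel   = λ a → does (count a xs ≟ℕ T)
    ; local = λ a b e → cong (λ c → does (c ≟ℕ T)) (count-cong a b xs λ x x∈ → e x (∈-members⁺ x x∈))
    }

  -- The state counts the true variables read so far, with `T + 1` as overflow state; hence `2 + T`
  -- states.
  step : Bool → Fin (2 + T) → Fin (2 + T)
  step true  = satSuc
  step false s = s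

  open Automaton {n} (2 + T) step (λ s → does (toℕ s ≟ℕ T))

  run-count : ∀ a π s c → toℕ s ≡ c ⊓ suc T → toℕ (run a π s) ≡ (c + count a π) ⊓ suc T
  run-count a []      s c e rewrite +-identityʳ c = e
  run-count a (x ∷ π) s c e with a x
  ... | false = run-count a π s c e
  ... | true  = trans (run-count a π (satSuc s) (suc c) e′)
                  (cong (_⊓ suc T) (sym (+-suc c (count a π))))
    where
    e′ : toℕ (satSuc s) ≡ suc c ⊓ suc T
    -- Truncating before the increment is harmless: the incremented cap is cut back to `suc T`
    -- anyway.
    e′ = trans (toℕ-satSuc s) (trans (cong (λ t → suc t ⊓ suc T) e)
           (trans (⊓-assoc (suc c) (2 + T) (suc T))
             (cong (suc c ⊓_) (m≥n⇒m⊓n≡n (n≤1+n (suc T))))))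

  -- The cap lies strictly above `T`, so truncation turns no other count into `T`.
  saturated-test : ∀ c → does (c ⊓ suc T ≟ℕ T) ≡ does (c ≟ℕ T)
  saturated-test c with c ≟ℕ T
  ... | yes refl = trans (dec-true (c ⊓ suc c ≟ℕ c) (m≤n⇒m⊓n≡m (n≤1+n c))) (sym (dec-true (c ≟ℕ c) refl))
  ... | no c≢T   = trans (dec-false (c ⊓ suc T ≟ℕ T) bad) (sym (dec-false (c ≟ℕ T) c≢T))
    where
    bad : c ⊓ suc T ≢ T
    bad e with ⊓-sel c (suc T)
    ... | inj₁ h = c≢T (trans (sym h) e)
    ... | inj₂ h = 1+n≢n (trans (sym h) e)

  -- Two repetition-free listings of one set are permutations of each other, and a sum is invariant
  -- under permutation.
  count-order : Unique xs → ∀ a π → IsOrderOf π members → count a π ≡ count a xs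
  count-order u a π (uπ , π⊆ , ⊆π) = sum-↭ (map⁺ (bit ∘ a) (∼bag⇒↭ (unique∧set⇒bag uπ u
    (mk⇔ (λ x∈ → ∈-members⁻ _ (π⊆ _ x∈)) (λ x∈ → ⊆π _ (∈-members⁺ _ x∈))))))

  cardinality-slim : Unique xs → ∀ {w} → 2 + T ≤ w → SlimOBDD cardinality w
  cardinality-slim u T≤w π ord@(uπ , _) =
    record { g = order ; nodes = bdd ; root = start zero }
    , (λ p p∈ → subst (λ q → (q ⊆ π) × (∀ x → x ∈ π → x ∈ q)) (sym (paths≡ zero p p∈))
        (⊆-refl , λ _ x∈ → x∈))
    , (λ x → ≤-trans (width uπ x) T≤w)
    , λ a → trans (eval≡ a zero)
              (trans (cong (λ c → does (c ≟ℕ T)) (run-count a π zero 0 refl))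
                (trans (saturated-test (count a π)) (cong (λ c → does (c ≟ℕ T)) (count-order u a π ord))))
    where
    open Unrolling (unroll π)

-- Treewidth

-- Positions in a tabulated list have type `Fin (length (tabulate f))`; comparing through `toℕ`
-- recovers the index a position comes from.
lookup-tabulate-toℕ : ∀ {A : Set} {n} (f : Fin n → A) (i : Fin (length (tabulate f))) →
  ∃ λ x → lookup (tabulate f) i ≡ f x × toℕ x ≡ toℕ i
lookup-tabulate-toℕ {n = suc n} f zero = zero , refl , refl
lookup-tabulate-toℕ {n = suc n} f (suc i) with lookup-tabulate-toℕ (f ∘ suc) i
... | x , e , t = suc x , e , cong suc t

SomeNodes-tabulate : ∀ {A : Set} {P : A → Set} {n} (f : Fin n → RTree A) x →
  SomeNode P (f x) → SomeNodes P (tabulate f)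
SomeNodes-tabulate f zero    h = hd h
SomeNodes-tabulate f (suc x) h = tl (SomeNodes-tabulate (f ∘ suc) x h)

AllNodesL-tabulate : ∀ {A : Set} {P : A → Set} {n} (f : Fin n → RTree A) →
  (∀ x → AllNodes P (f x)) → AllNodesL P (tabulate f)
AllNodesL-tabulate {n = zero}  f h = tt
AllNodesL-tabulate {n = suc n} f h = h zero , AllNodesL-tabulate (f ∘ suc) (h ∘ suc)

ConnL-tabulate : ∀ {V : Set} {v : V} {n} (f : Fin n → RTree (List V)) →
  (∀ x → Conn v (f x)) → ConnL v (tabulate f)
ConnL-tabulate {n = zero}  f h = tt
ConnL-tabulate {n = suc n} f h = h zero , ConnL-tabulate (f ∘ suc) (h ∘ suc)

module Star {n : ℕ} (F : System n) where

  centre : List (IVertex F)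
  centre = tabulate inj₁

  ray : Fin n → RTree (List (IVertex F))
  ray x = node (inj₂ x ∷ centre) []

  ray-bag : ∀ {v} x → SomeNode (v ∈_) (ray x) → v ∈ inj₂ x ∷ centre
  ray-bag x (here h) = h

  constraint∈centre : ∀ i → inj₁ i ∈ centre
  constraint∈centre i = ∈-tabulate⁺ i

  variable∉centre : ∀ x → ¬ (inj₂ x ∈ centre)
  variable∉centre x h with ∈-tabulate⁻ h
  ... | _ , ()

  variable-ray : ∀ x y → inj₂ x ∈ inj₂ y ∷ centre → x ≡ y
  variable-ray x .x (here refl) = refl
  variable-ray x y (there h) = ⊥-elim (variable∉centre x h)

  -- A constraint lies in the centre and in every ray; a variable lies in a single ray and not in
  -- the centre. These are the two cases of `Conn`.
  star-connected : ∀ v → Conn v (node centre (tabulate ray))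
  star-connected v =
    ConnL-tabulate ray (λ x → tt , (λ _ ()) , (λ _ ()))
    , (λ v∈ i _ → keep v∈ i)
    , λ v∉ i j → unique v v∉ i j
    where
    keep : v ∈ centre → ∀ i → v ∈ rootLabel (lookup (tabulate ray) i)
    keep v∈ i with lookup-tabulate-toℕ ray i
    ... | x , e , _ rewrite e = there v∈

    unique : ∀ v → ¬ (v ∈ centre) → ∀ i j → SomeNode (v ∈_) (lookup (tabulate ray) i) →
      SomeNode (v ∈_) (lookup (tabulate ray) j) → i ≡ j
    unique (inj₁ c) v∉ i j = ⊥-elim (v∉ (constraint∈centre c))
    unique (inj₂ y) v∉ i j hi hj with lookup-tabulate-toℕ ray i | lookup-tabulate-toℕ ray j
    ... | x , e , t | x′ , e′ , t′ rewrite e | e′ =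
      toℕ-injective (trans (sym t) (trans (cong toℕ
        (trans (sym (variable-ray y x (ray-bag x hi))) (variable-ray y x′ (ray-bag x′ hj)))) t′))

  -- Each edge is covered by the ray of its variable. The largest bags, the rays, hold all
  -- constraints and one variable, and the extra vertex is the `suc` of the bag size.
  star-decomposition : ∀ {w} → m F ≤ w → IncidenceTreewidth≤ F w
  star-decomposition {w} m≤w = record
    { tree      = node centre (tabulate ray)
    ; coverV    = λ { (inj₁ i) → here (constraint∈centre i)
                    ; (inj₂ x) → there (SomeNodes-tabulate ray x (here (here refl))) }
    ; coverE    = λ { (inj₁ i) (inj₂ x) _ → there (SomeNodes-tabulate ray x
                        (here (there (constraint∈centre i) , here refl)))
                    ; (inj₂ x) (inj₁ i) _ → there (SomeNodes-tabulate ray x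
                        (here (here refl , there (constraint∈centre i))))
                    ; (inj₁ _) (inj₁ _) ()
                    ; (inj₂ _) (inj₂ _) () }
    ; connected = star-connected
    ; bagSize   = m≤n⇒m≤1+n centre≤w , AllNodesL-tabulate ray λ x → s≤s centre≤w , tt
    }
    where
    centre≤w : length centre ≤ w
    centre≤w = subst (_≤ w) (sym (length-tabulate inj₁)) m≤w

-- Structured circuits and rectangles

gates≤size : ∀ {n g} (C : Circ n g) → g ≤ size C
gates≤size [] = z≤n
gates≤size (k ∷ C) = s≤s (≤-trans (gates≤size C) (m≤n+m _ (arity k)))

occ-suc : ∀ {n g} (k : Gate n g) (C : Circ n g) x i → occ C x i → occ (k ∷ C) x (suc i)
occ-suc (const _) C x i o = o
occ-suc (lit _ _) C x i o = o
occ-suc (and _ _) C x i o = o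
occ-suc (or _ _) C x i o = o

∧-true : ∀ {b c} → b ∧ c ≡ true → b ≡ true × c ≡ true
∧-true {true} {true} _ = refl , refl

eval-local : ∀ {n g} (C : Circ n g) (a b : Assignment n) i →
  (∀ x → occ C x i → a x ≡ b x) → eval C a i ≡ eval C b i
eval-local (const _ ∷ C) a b zero e = refl
eval-local (lit x true ∷ C) a b zero e = e x refl
eval-local (lit x false ∷ C) a b zero e = cong not (e x refl)
eval-local (and i j ∷ C) a b zero e =
  cong₂ _∧_ (eval-local C a b i λ x o → e x (inj₁ o)) (eval-local C a b j λ x o → e x (inj₂ o))
eval-local (or i j ∷ C) a b zero e =
  cong₂ _∨_ (eval-local C a b i λ x o → e x (inj₁ o)) (eval-local C a b j λ x o → e x (inj₂ o))
eval-local (k ∷ C) a b (suc i) e = eval-local C a b i λ x o → e x (occ-suc k C x i o)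

module Rectangles {n : ℕ} (S : Fin n → Bool) where

  Only : ∀ {g} → Bool → Circ n g → Fin g → Set
  Only b C i = ∀ x → occ C x i → S x ≡ b

  -- What structuredness leaves of an ∧-gate once a partition is fixed: the gate reads one side
  -- only, or one of its children avoids `S`.
  RespectsGate : ∀ {g} → Circ n g → Gate n g → Set
  RespectsGate C (and i j) =
    (∃ λ b → Only b C i × Only b C j) ⊎ Only false C i ⊎ Only false C j
  RespectsGate C _ = ⊤

  Respects : ∀ {g} → Circ n g → Set
  Respects [] = ⊤
  Respects (k ∷ C) = RespectsGate C k × Respects C

  mix : Assignment n → Assignment n → Assignment n
  mix a b x = if S x then b x else a x

  -- Follows a certificate of a downwards, at every ∧-gate into the child that
  -- may depend on S, until a gate that reads only one side of the partition.
  stop : ∀ {g} (C : Circ n g) → Respects C → Assignment n → Fin g → Fin g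
  stop (k ∷ C) (_ , ok) a (suc i) = suc (stop C ok a i)
  stop (const _ ∷ C) ok a zero = zero
  stop (lit _ _ ∷ C) ok a zero = zero
  stop (and i j ∷ C) (inj₁ _ , ok) a zero = zero
  stop (and i j ∷ C) (inj₂ (inj₁ _) , ok) a zero = suc (stop C ok a j)
  stop (and i j ∷ C) (inj₂ (inj₂ _) , ok) a zero = suc (stop C ok a i)
  stop (or i j ∷ C) (_ , ok) a zero = suc (if eval C a i then stop C ok a i else stop C ok a j)

  Only-suc : ∀ {g} {b} (k : Gate n g) (C : Circ n g) i → Only b C i → Only b (k ∷ C) (suc i)
  Only-suc (const _) C i h = h
  Only-suc (lit _ _) C i h = h
  Only-suc (and _ _) C i h = h
  Only-suc (or _ _) C i h = h

  stop-only : ∀ {g} (C : Circ n g) (ok : Respects C) a i → ∃ λ b → Only b C (stop C ok a i)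
  stop-only (const _ ∷ C) ok a zero = true , λ _ ()
  stop-only (lit x _ ∷ C) ok a zero = S x , λ { _ refl → refl }
  stop-only (and i j ∷ C) (inj₁ (b , hi , hj) , ok) a zero =
    b , λ { x (inj₁ o) → hi x o ; x (inj₂ o) → hj x o }
  stop-only (and i j ∷ C) (inj₂ (inj₁ _) , ok) a zero = stop-only C ok a j
  stop-only (and i j ∷ C) (inj₂ (inj₂ _) , ok) a zero = stop-only C ok a i
  stop-only (or i j ∷ C) (_ , ok) a zero with eval C a i
  ... | true  = stop-only C ok a i
  ... | false = stop-only C ok a j
  stop-only (k ∷ C) (_ , ok) a (suc i) with stop-only C ok a i
  ... | b , h = b , Only-suc k C _ h

  -- A true ∧-gate has two true children, and at a true ∨-gate the walk chooses a true one, so it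
  -- never leaves the gates satisfied by `a`.
  stop-true : ∀ {g} (C : Circ n g) (ok : Respects C) a i →
    eval C a i ≡ true → eval C a (stop C ok a i) ≡ true
  stop-true (const _ ∷ C) ok a zero e = e
  stop-true (lit x _ ∷ C) ok a zero e = e
  stop-true (and i j ∷ C) (inj₁ _ , ok) a zero e = e
  stop-true (and i j ∷ C) (inj₂ (inj₁ _) , ok) a zero e = stop-true C ok a j (proj₂ (∧-true e))
  stop-true (and i j ∷ C) (inj₂ (inj₂ _) , ok) a zero e = stop-true C ok a i (proj₁ (∧-true e))
  stop-true (or i j ∷ C) (_ , ok) a zero e with eval C a i in eq
  ... | true  = stop-true C ok a i eq
  ... | false = stop-true C ok a j e
  stop-true (k ∷ C) (_ , ok) a (suc i) e = stop-true C ok a i e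

  mix-false : ∀ a b x → S x ≡ false → a x ≡ mix a b x
  mix-false a b x e rewrite e = refl

  mix-true : ∀ a b x → S x ≡ true → b x ≡ mix a b x
  mix-true a b x e rewrite e = refl

  -- At an ∧-gate the abandoned child avoids `S`, where `mix a b` agrees with `a`, so it stays true;
  -- at an ∨-gate one true child suffices. Truth thus climbs back from the stopping gate.
  stop-lift : ∀ {g} (C : Circ n g) (ok : Respects C) a b i → eval C a i ≡ true →
    eval C (mix a b) (stop C ok a i) ≡ true → eval C (mix a b) i ≡ true
  stop-lift (const _ ∷ C) ok a b zero e h = h
  stop-lift (lit x _ ∷ C) ok a b zero e h = h
  stop-lift (and i j ∷ C) (inj₁ _ , ok) a b zero e h = h
  stop-lift (and i j ∷ C) (inj₂ (inj₁ o) , ok) a b zero e h =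
    cong₂ _∧_
      (trans (sym (eval-local C a (mix a b) i λ x p → mix-false a b x (o x p))) (proj₁ (∧-true e)))
      (stop-lift C ok a b j (proj₂ (∧-true e)) h)
  stop-lift (and i j ∷ C) (inj₂ (inj₂ o) , ok) a b zero e h =
    cong₂ _∧_
      (stop-lift C ok a b i (proj₁ (∧-true e)) h)
      (trans (sym (eval-local C a (mix a b) j λ x p → mix-false a b x (o x p)))
        (proj₂ (∧-true {eval C a i} e)))
  stop-lift (or i j ∷ C) (_ , ok) a b zero e h with eval C a i in eq
  ... | true  = cong (_∨ eval C (mix a b) j) (stop-lift C ok a b i eq h)
  ... | false = trans (cong (eval C (mix a b) i ∨_) (stop-lift C ok a b j e h)) (∨-zeroʳ _)
  stop-lift (k ∷ C) (_ , ok) a b (suc i) e h = stop-lift C ok a b i e h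

  -- The common stopping gate is true under both `a` and `b` and reads one side only. On that side
  -- the mix agrees with one of them, so the gate is true under the mix as well, and `stop-lift`
  -- applies.
  mix-sat : ∀ {g} (C : Circ n g) (ok : Respects C) a b i →
    eval C a i ≡ true → eval C b i ≡ true → stop C ok a i ≡ stop C ok b i →
    eval C (mix a b) i ≡ true
  mix-sat C ok a b i ea eb same with stop-only C ok a i
  ... | false , o = stop-lift C ok a b i ea
        (trans (sym (eval-local C a (mix a b) _ λ x p → mix-false a b x (o x p)))
          (stop-true C ok a i ea))
  ... | true , o = stop-lift C ok a b i ea
        (trans (sym (eval-local C b (mix a b) _ λ x p → mix-true a b x (o x p)))
          (subst (λ h → eval C b h ≡ true) (sym same) (stop-true C ok b i eb)))

-- Positions of gates relative to a node of the vtree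

below : ∀ {n} → VTree n → Fin n → Bool
below (leaf y)   x = does (x ≟ y)
below (node l r) x = below l x ∨ below r x

below-true : ∀ {n} (t : VTree n) x → x ∈ leaves t → below t x ≡ true
below-true (leaf y) x (here refl) = dec-true (x ≟ x) refl
below-true (node l r) x x∈ with ∈-++⁻ (leaves l) x∈
... | inj₁ h rewrite below-true l x h = refl
... | inj₂ h rewrite below-true r x h = ∨-zeroʳ _

below-false : ∀ {n} (t : VTree n) x → ¬ (x ∈ leaves t) → below t x ≡ false
below-false (leaf y) x x∉ = dec-false (x ≟ y) (x∉ ∘ here)
below-false (node l r) x x∉
  rewrite below-false l x (x∉ ∘ ∈-++⁺ˡ) | below-false r x (x∉ ∘ ∈-++⁺ʳ (leaves l)) = refl

data Diverge : List Dir → List Dir → Set where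
  LR   : ∀ {p q} → Diverge (L ∷ p) (R ∷ q)
  RL   : ∀ {p q} → Diverge (R ∷ p) (L ∷ q)
  step : ∀ {d p q} → Diverge p q → Diverge (d ∷ p) (d ∷ q)

-- The node `q` is at or below `p`, strictly above `p`, or incomparable to `p`. In the second case
-- `d` tells which child of `q` leads to `p`.
data Compare (p : List Dir) : List Dir → Set where
  extends  : ∀ r → Compare p (p ++ r)
  prefix   : ∀ {q} d r → p ≡ q ++ d ∷ r → Compare p q
  diverges : ∀ {q} → Diverge p q → Compare p q

compare-∷ : ∀ {p q} d → Compare p q → Compare (d ∷ p) (d ∷ q)
compare-∷ d (extends r) = extends r
compare-∷ d (prefix d′ r e) = prefix d′ r (cong (d ∷_) e)
compare-∷ d (diverges h) = diverges (step h)

compare : ∀ p q → Compare p q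
compare [] q = extends q
compare (d ∷ p) [] = prefix d p refl
compare (L ∷ p) (L ∷ q) = compare-∷ L (compare p q)
compare (L ∷ p) (R ∷ q) = diverges LR
compare (R ∷ p) (L ∷ q) = diverges RL
compare (R ∷ p) (R ∷ q) = compare-∷ R (compare p q)

diverge-LR : ∀ q {r s} → Diverge (q ++ L ∷ r) (q ++ R ∷ s)
diverge-LR [] = LR
diverge-LR (d ∷ q) = step (diverge-LR q)

diverge-RL : ∀ q {r s} → Diverge (q ++ R ∷ r) (q ++ L ∷ s)
diverge-RL [] = RL
diverge-RL (d ∷ q) = step (diverge-RL q)

varsAt-all : ∀ {n} (t : VTree n) p {x} → x ∈ varsAt t p → x ∈ leaves t
varsAt-all t [] h = h
varsAt-all (node l r) (L ∷ p) h = ∈-++⁺ˡ (varsAt-all l p h)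
varsAt-all (node l r) (R ∷ p) h = ∈-++⁺ʳ (leaves l) (varsAt-all r p h)

varsAt-++ : ∀ {n} (t : VTree n) p r {x} → x ∈ varsAt t (p ++ r) → x ∈ varsAt t p
varsAt-++ t [] r h = varsAt-all t r h
varsAt-++ (node l _) (L ∷ p) r h = varsAt-++ l p r h
varsAt-++ (node _ l) (R ∷ p) r h = varsAt-++ l p r h

subAt-++ : ∀ {n} (t : VTree n) p r {s} → subAt t p ≡ just s → subAt t (p ++ r) ≡ subAt s r
subAt-++ t [] r refl = refl
subAt-++ (node l _) (L ∷ p) r e = subAt-++ l p r e
subAt-++ (node _ l) (R ∷ p) r e = subAt-++ l p r e

Unique-++ : ∀ {A : Set} (xs : List A) {ys} → Unique (xs ++ ys) →
  Unique xs × Unique ys × (∀ {x} → x ∈ xs → x ∈ ys → ⊥)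
Unique-++ [] u = [] , u , λ ()
Unique-++ (x ∷ xs) {ys} (h ∷ u) with Unique-++ xs u
... | ux , uy , dis = All-++⁻ˡ xs h ∷ ux , uy ,
    λ { (here refl) y∈ → All-lookup (All-++⁻ʳ xs h) y∈ refl ; (there x∈) y∈ → dis x∈ y∈ }

-- Where the paths part they enter different children of one node, and without repeated leaves these
-- share no variable.
varsAt-disjoint : ∀ {n} (t : VTree n) → Unique (leaves t) → ∀ {p q x} → Diverge p q →
  x ∈ varsAt t p → x ∈ varsAt t q → ⊥
varsAt-disjoint (node l r) u (LR {p} {q}) hp hq with Unique-++ (leaves l) u
... | _ , _ , dis = dis (varsAt-all l p hp) (varsAt-all r q hq)
varsAt-disjoint (node l r) u (RL {p} {q}) hp hq with Unique-++ (leaves l) u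
... | _ , _ , dis = dis (varsAt-all l q hq) (varsAt-all r p hp)
varsAt-disjoint (node l r) u (step {L} h) hp hq with Unique-++ (leaves l) u
... | ul , _ , _ = varsAt-disjoint l ul h hp hq
varsAt-disjoint (node l r) u (step {R} h) hp hq with Unique-++ (leaves l) u
... | _ , ur , _ = varsAt-disjoint r ur h hp hq

-- The ∧-clause of `GateOK` with the labels as parameters, so that it can be restated for the tail
-- of a circuit, where positions are renumbered.
AndLabel : ∀ {g h} → (Fin g → List Dir) → List Dir → Gate h g → Set
AndLabel lb q (and i j) = (∃ λ r → lb i ≡ q ++ L ∷ r) × (∃ λ r → lb j ≡ q ++ R ∷ r)
AndLabel lb q _ = ⊤

module _ {n : ℕ} (τ : VTree n) (uniq : Unique (leaves τ))
         (p : List Dir) (t : VTree n) (at : subAt τ p ≡ just t) where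

  open Rectangles (below t)

  varsAt⇒leaves : ∀ {x} → x ∈ varsAt τ p → x ∈ leaves t
  varsAt⇒leaves {x} = subst (λ s → x ∈ maybe leaves [] s) at

  leaves⇒varsAt : ∀ {x} → x ∈ leaves t → x ∈ varsAt τ p
  leaves⇒varsAt {x} = subst (λ s → x ∈ maybe leaves [] s) (sym at)

  only-extends : ∀ {g} (C : Circ n g) i {q} → (∀ x → occ C x i → x ∈ varsAt τ q) →
    ∀ r → q ≡ p ++ r → Only true C i
  only-extends C i vars r refl x o = below-true t x (varsAt⇒leaves (varsAt-++ τ p r (vars x o)))

  only-diverges : ∀ {g} (C : Circ n g) i {q} → (∀ x → occ C x i → x ∈ varsAt τ q) →
    Diverge p q → Only false C i
  only-diverges C i vars d x o =
    below-false t x λ x∈ → varsAt-disjoint τ uniq d (leaves⇒varsAt x∈) (vars x o)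

  -- A gate at or below `p` reads only variables of `t`, a gate incomparable to `p` reads none of
  -- them. If the gate is strictly above `p`, then `p` lies below one child of its node, and the
  -- gate's other child reads nothing from `t`.
  respects-gate : ∀ {g} (C : Circ n g) (k : Gate n g) (lb : Fin g → List Dir) q →
    (∀ i x → occ C x i → x ∈ varsAt τ (lb i)) → (∀ x → occ (k ∷ C) x zero → x ∈ varsAt τ q) →
    AndLabel lb q k → RespectsGate C k
  respects-gate C (const _) lb q vars vars₀ ok = tt
  respects-gate C (lit _ _) lb q vars vars₀ ok = tt
  respects-gate C (or _ _) lb q vars vars₀ ok = tt
  respects-gate C (and i j) lb q vars vars₀ ((ri , ei) , (rj , ej)) with compare p q
  ... | extends r = inj₁ (true ,
          only-extends C i (λ x → vars₀ x ∘ inj₁) r refl , only-extends C j (λ x → vars₀ x ∘ inj₂) r refl)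
  ... | diverges d = inj₁ (false ,
          only-diverges C i (λ x → vars₀ x ∘ inj₁) d , only-diverges C j (λ x → vars₀ x ∘ inj₂) d)
  ... | prefix L r e = inj₂ (inj₂ (only-diverges C j (vars j)
          (subst (λ z → Diverge z (lb j)) (sym e) (subst (Diverge _) (sym ej) (diverge-LR q)))))
  ... | prefix R r e = inj₂ (inj₁ (only-diverges C i (vars i)
          (subst (λ z → Diverge z (lb i)) (sym e) (subst (Diverge _) (sym ei) (diverge-RL q)))))

  respects : ∀ {g} (C : Circ n g) (lb : Fin g → List Dir) →
    (∀ i x → occ C x i → x ∈ varsAt τ (lb i)) →
    (∀ i → AndLabel lb (lb i) (gateAt C i)) → Respects C
  respects [] lb vars ok = tt
  respects (k ∷ C) lb vars ok =
    respects-gate C k (lb ∘ suc) (lb zero) vars′ (vars zero) (unmap k (lb zero) (ok zero))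
    , respects C (lb ∘ suc) vars′ (λ i → unmap (gateAt C i) (lb (suc i)) (ok (suc i)))
    where
    vars′ : ∀ i x → occ C x i → x ∈ varsAt τ (lb (suc i))
    vars′ i x o = vars (suc i) x (occ-suc k C x i o)

    -- `gateAt` gives children as positions in the whole circuit; this passes to positions in its
    -- tail.
    unmap : ∀ (k : Gate n _) q → AndLabel lb q (mapGate suc k) → AndLabel (lb ∘ suc) q k
    unmap (const _) q h = tt
    unmap (lit _ _) q h = tt
    unmap (and _ _) q h = h
    unmap (or _ _)  q h = tt

dsdnnf-respects : ∀ {n G} (D : DSDNNF n G) p t → subAt (vtree D) p ≡ just t →
  Rectangles.Respects (below t) (circ D)
dsdnnf-respects D p t at = respects (vtree D) (leavesUniq D) p t at (circ D) (lab D) (labVars D)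
  λ g → andLabel g (gateAt (circ D) g) (gatesOK D g)
  where
  andLabel : ∀ g k → GateOK (circ D) (lab D) g k →
    AndLabel (lab D) (lab D g) k
  andLabel g (const _) h = tt
  andLabel g (lit _ _) h = tt
  andLabel g (and _ _) h = h
  andLabel g (or _ _)  h = tt

-- Disjoint bichromatic minors of a grid

module Grid (K : ℕ) where

  -- Otherwise, sending each element to a position where it occurs would inject `Fin K` into fewer
  -- than `K` positions.
  fresh : ∀ (xs : List (Fin K)) → length xs < K → ∃ λ x → x ∉ xs
  fresh xs len = ¬∀⟶∃¬ K (_∈ xs) (_∈? xs) λ all → <⇒≱ len
    (injective⇒≤ {f = index ∘ all} λ {i} {j} e → trans (lookup-index (all i))
      (trans (cong (lookup xs) e) (sym (lookup-index (all j)))))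

  Covered : ℕ → (Fin K → Fin K → Set) → Set
  Covered B P = ∃ λ rs → ∃ λ cs → length rs ≤ B × length cs ≤ B × (∀ i j → P i j → i ∈ rs ⊎ j ∈ cs)

  Covered-mono : ∀ {B B′ P} → B ≤ B′ → Covered B P → Covered B′ P
  Covered-mono B≤ (rs , cs , lr , lc , h) = rs , cs , ≤-trans lr B≤ , ≤-trans lc B≤ , h

  Injective₂ : ∀ {s} → (Fin s → Bool → Fin K) → Set
  Injective₂ pos = ∀ {s b s′ b′} → pos s b ≡ pos s′ b′ → (s , b) ≡ (s′ , b′)

  used : ∀ {s} → (Fin s → Bool → Fin K) → List (Fin K)
  used {zero}  pos = []
  used {suc s} pos = pos zero false ∷ pos zero true ∷ used (pos ∘ suc)

  length-used : ∀ {s} (pos : Fin s → Bool → Fin K) → length (used pos) ≡ s * 2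
  length-used {zero}  pos = refl
  length-used {suc s} pos = cong (2 +_) (length-used (pos ∘ suc))

  ∈-used : ∀ {s} (pos : Fin s → Bool → Fin K) i b → pos i b ∈ used pos
  ∈-used pos zero false = here refl
  ∈-used pos zero true  = there (here refl)
  ∈-used pos (suc i) b  = there (there (∈-used (pos ∘ suc) i b))

  extend : ∀ {s} → (Fin s → Bool → Fin K) → Fin K → Fin K → Fin (suc s) → Bool → Fin K
  extend pos x y zero false = x
  extend pos x y zero true  = y
  extend pos x y (suc i) b  = pos i b

  extend-injective : ∀ {s} (pos : Fin s → Bool → Fin K) → Injective₂ pos → ∀ {x y} →
    x ∉ used pos → y ∉ used pos → x ≢ y → Injective₂ (extend pos x y)
  extend-injective pos inj {x} {y} x∉ y∉ x≢y = go _ _ _ _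
    where
    go : ∀ s b s′ b′ → extend pos x y s b ≡ extend pos x y s′ b′ → (s , b) ≡ (s′ , b′)
    go zero false zero false e = refl
    go zero false zero true e = ⊥-elim (x≢y e)
    go zero true zero false e = ⊥-elim (x≢y (sym e))
    go zero true zero true e = refl
    go zero false (suc s′) b′ e = ⊥-elim (x∉ (subst (_∈ used pos) (sym e) (∈-used pos s′ b′)))
    go zero true (suc s′) b′ e = ⊥-elim (y∉ (subst (_∈ used pos) (sym e) (∈-used pos s′ b′)))
    go (suc s) b zero false e = ⊥-elim (x∉ (subst (_∈ used pos) e (∈-used pos s b)))
    go (suc s) b zero true e = ⊥-elim (y∉ (subst (_∈ used pos) e (∈-used pos s b)))
    go (suc s) b (suc s′) b′ e with refl ← inj e = refl

  module Colouring (rich : Bool → Fin K → Fin K → Set) where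

    -- A minor is listed so that its bichromatic line is its first row or first column.
    record Minors (s : ℕ) : Set where
      field
        row col     : Fin s → Bool → Fin K
        row-inj     : Injective₂ row
        col-inj     : Injective₂ col
        colour      : Fin K → Fin K → Bool
        rich-colour : ∀ i j → rich (colour i j) i j
        split       : ∀ i →
          colour (row i false) (col i false) ≢ colour (row i false) (col i true) ⊎
          colour (row i false) (col i false) ≢ colour (row i true) (col i false)

    -- Cells rich on both sides may have either colour; recolouring them makes a newly found minor
    -- bichromatic.
    set : Fin K → Fin K → Bool → (Fin K → Fin K → Bool) → Fin K → Fin K → Bool
    set x y b c i j = if does (i ≟ x) ∧ does (j ≟ y) then b else c i j

    set-≡ : ∀ x y b c → set x y b c x y ≡ b
    set-≡ x y b c rewrite dec-true (x ≟ x) refl | dec-true (y ≟ y) refl = refl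

    set-≢ˡ : ∀ {x} y b c {i} j → i ≢ x → set x y b c i j ≡ c i j
    set-≢ˡ {x} y b c {i} j i≢x rewrite dec-false (i ≟ x) i≢x = refl

    set-≢ʳ : ∀ x {y} b c i {j} → j ≢ y → set x y b c i j ≡ c i j
    set-≢ʳ x {y} b c i {j} j≢y rewrite dec-false (j ≟ y) j≢y with does (i ≟ x)
    ... | true  = refl
    ... | false = refl

    set-rich : ∀ {x y b c} → rich b x y → (∀ i j → rich (c i j) i j) →
      ∀ i j → rich (set x y b c i j) i j
    set-rich {x} {y} rb rc i j with i ≟ x | j ≟ y
    ... | yes refl | yes refl = rb
    ... | yes _    | no _     = rc i j
    ... | no _     | yes _    = rc i j
    ... | no _     | no _     = rc i j

    module Greedy (rich? : ∀ b i j → Dec (rich b i j))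
                  (rich-total : ∀ i j → rich true i j ⊎ rich false i j) where

      empty : Minors 0
      empty = record
        { row = λ () ; col = λ () ; row-inj = λ { {()} } ; col-inj = λ { {()} }
        ; colour      = λ i j → does (rich? true i j)
        ; rich-colour = rc
        ; split       = λ ()
        }
        where
        rc : ∀ i j → rich (does (rich? true i j)) i j
        rc i j with rich? true i j | rich-total i j
        ... | yes h | _      = h
        ... | no _  | inj₂ h = h
        ... | no ¬h | inj₁ h = ⊥-elim (¬h h)

      module Step {s} (M : Minors s) (room : suc s * 2 ≤ K) where
        open Minors M

        U V : List (Fin K)
        U = used row
        V = used col

        other : ∀ (pos : Fin s → Bool → Fin K) x → ∃ λ y → y ∉ used pos × x ≢ y
        other pos x with fresh (x ∷ used pos) (subst (λ l → 2 + l ≤ K) (sym (length-used pos)) room)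
        ... | y , y∉ = y , y∉ ∘ there , λ e → y∉ (here (sym e))

        add : ∀ {i i′ j j′ x y} → i ∉ U → i′ ∉ U → i ≢ i′ → j ∉ V → j′ ∉ V → j ≢ j′ →
          rich true i j → rich false x y → x ∉ U →
          ((x ≡ i × y ≡ j′) ⊎ (x ≡ i′ × y ≡ j)) → Minors (suc s)
        add {i} {i′} {j} {j′} {x} {y} i∉ i′∉ i≢ j∉ j′∉ j≢ rt rf x∉ loc = record
          { row = extend row i i′ ; col = extend col j j′
          ; row-inj = extend-injective row row-inj i∉ i′∉ i≢
          ; col-inj = extend-injective col col-inj j∉ j′∉ j≢
          ; colour = colour′
          ; rich-colour = set-rich rt (set-rich rf rich-colour)
          ; split = split′
          }
          where
          colour₁ = set x y false colour
          colour′ = set i j true colour₁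

          old : ∀ k b j → colour′ (row k b) j ≡ colour (row k b) j
          old k b j₁ = trans
            (set-≢ˡ j true colour₁ j₁ λ e → i∉ (subst (_∈ U) e (∈-used row k b)))
            (set-≢ˡ y false colour j₁ λ e → x∉ (subst (_∈ U) e (∈-used row k b)))

          t≢f : ∀ {b c} → b ≡ true → c ≡ false → b ≢ c
          t≢f refl refl ()

          at : ∀ {x₁ y₁} → x ≡ x₁ → y ≡ y₁ → set x y false colour x₁ y₁ ≡ false
          at refl refl = set-≡ x y false colour

          new : ((x ≡ i × y ≡ j′) ⊎ (x ≡ i′ × y ≡ j)) →
            colour′ i j ≢ colour′ i j′ ⊎ colour′ i j ≢ colour′ i′ j
          new (inj₁ (ex , ey)) = inj₁ (t≢f (set-≡ i j true colour₁)
            (trans (set-≢ʳ i true colour₁ i (j≢ ∘ sym)) (at ex ey)))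
          new (inj₂ (ex , ey)) = inj₂ (t≢f (set-≡ i j true colour₁)
            (trans (set-≢ˡ j true colour₁ j (i≢ ∘ sym)) (at ex ey)))

          split′ : ∀ k → colour′ (extend row i i′ k false) (extend col j j′ k false) ≢
                           colour′ (extend row i i′ k false) (extend col j j′ k true) ⊎
                         colour′ (extend row i i′ k false) (extend col j j′ k false) ≢
                           colour′ (extend row i i′ k true) (extend col j j′ k false)
          split′ zero = new loc
          split′ (suc k)
            rewrite old k false (col k false) | old k false (col k true) | old k true (col k false)
            = split k

        RowSplit ColSplit : Fin K → Fin K → Fin K → Set
        RowSplit i j j′ = i ∉ U × j ∉ V × j′ ∉ V × j ≢ j′ × rich true i j × rich false i j′
        ColSplit i i′ j = i ∉ U × i′ ∉ U × j ∉ V × i ≢ i′ × rich true i j × rich false i′ j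

        rowSplit? : Dec (∃ λ i → ∃ λ j → ∃ λ j′ → RowSplit i j j′)
        rowSplit? = any? λ i → any? λ j → any? λ j′ →
          ¬? (i ∈? U) ×-dec ¬? (j ∈? V) ×-dec ¬? (j′ ∈? V) ×-dec ¬? (j ≟ j′)
          ×-dec rich? true i j ×-dec rich? false i j′

        colSplit? : Dec (∃ λ i → ∃ λ i′ → ∃ λ j → ColSplit i i′ j)
        colSplit? = any? λ i → any? λ i′ → any? λ j →
          ¬? (i ∈? U) ×-dec ¬? (i′ ∈? U) ×-dec ¬? (j ∈? V) ×-dec ¬? (i ≟ i′)
          ×-dec rich? true i j ×-dec rich? false i′ j

        covered : ∀ {b} → (∀ i j → i ∉ U → j ∉ V → ¬ rich b i j) → Covered (s * 2) (rich b)
        covered {b} none = U , V , ≤-reflexive (length-used row) , ≤-reflexive (length-used col) , hit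
          where
          hit : ∀ i j → rich b i j → i ∈ U ⊎ j ∈ V
          hit i j r with i ∈? U | j ∈? V
          ... | yes i∈ | _      = inj₁ i∈
          ... | no _   | yes j∈ = inj₂ j∈
          ... | no i∉  | no j∉  = ⊥-elim (none i j i∉ j∉ r)

        -- A true-rich and a false-rich cell on a common line would form a split. If they share no
        -- line, the corner `(i , j₂)` is rich in some colour and forms a split with one of them.
        monochromatic : ¬ (∃ λ i → ∃ λ j → ∃ λ j′ → RowSplit i j j′) →
          ¬ (∃ λ i → ∃ λ i′ → ∃ λ j → ColSplit i i′ j) →
          ∀ i j → i ∉ U → j ∉ V → rich true i j → ∀ i₂ j₂ → i₂ ∉ U → j₂ ∉ V → ¬ rich false i₂ j₂
        monochromatic ¬row ¬col i j i∉ j∉ r i₂ j₂ i₂∉ j₂∉ r₂ with i ≟ i₂ | j ≟ j₂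
        ... | yes refl | no j≢ = ¬row (i , j , j₂ , i∉ , j∉ , j₂∉ , j≢ , r , r₂)
        ... | no i≢ | yes refl = ¬col (i , i₂ , j , i∉ , i₂∉ , j∉ , i≢ , r , r₂)
        ... | no i≢ | no j≢ with rich-total i j₂
        ...   | inj₁ h = ¬col (i , i₂ , j₂ , i∉ , i₂∉ , j₂∉ , i≢ , h , r₂)
        ...   | inj₂ h = ¬row (i , j , j₂ , i∉ , j∉ , j₂∉ , j≢ , r , h)
        -- One cell rich in both colours forms a split with any other free cell of its row, whatever
        -- the colour of that cell.
        monochromatic ¬row ¬col i j i∉ j∉ r i₂ j₂ i₂∉ j₂∉ r₂ | yes refl | yes refl with other col j
        ...   | j₃ , j₃∉ , j≢ with rich-total i j₃
        ...     | inj₁ h = ¬row (i , j₃ , j , i∉ , j₃∉ , j∉ , j≢ ∘ sym , h , r₂)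
        ...     | inj₂ h = ¬row (i , j , j₃ , i∉ , j∉ , j₃∉ , j≢ , r , h)

        -- Without a split, one colour is missing among the cells off the used lines, so the used
        -- rows and columns cover all cells rich in that colour.
        extend-or-cover : Minors (suc s) ⊎ Covered (s * 2) (rich true) ⊎ Covered (s * 2) (rich false)
        extend-or-cover with rowSplit?
        ... | yes (i , j , j′ , i∉ , j∉ , j′∉ , j≢ , rt , rf) with other row i
        ...   | i′ , i′∉ , i≢ = inj₁ (add i∉ i′∉ i≢ j∉ j′∉ j≢ rt rf i∉ (inj₁ (refl , refl)))
        extend-or-cover | no ¬row with colSplit?
        ... | yes (i , i′ , j , i∉ , i′∉ , j∉ , i≢ , rt , rf) with other col j
        ...   | j′ , j′∉ , j≢ = inj₁ (add i∉ i′∉ i≢ j∉ j′∉ j≢ rt rf i′∉ (inj₂ (refl , refl)))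
        extend-or-cover | no ¬row | no ¬col
          with any? (λ i → any? λ j → ¬? (i ∈? U) ×-dec ¬? (j ∈? V) ×-dec rich? true i j)
        ... | yes (i , j , i∉ , j∉ , r) = inj₂ (inj₂ (covered (monochromatic ¬row ¬col i j i∉ j∉ r)))
        ... | no none = inj₂ (inj₁ (covered λ i j i∉ j∉ r → none (i , j , i∉ , j∉ , r)))

      greedy : ∀ s → s * 2 ≤ K → Minors s ⊎ Covered (s * 2) (rich true) ⊎ Covered (s * 2) (rich false)
      greedy zero    _ = inj₁ empty
      greedy (suc s) room with greedy s (≤-trans (m≤n+m (s * 2) 2) room)
      ... | inj₂ (inj₁ c) = inj₂ (inj₁ (Covered-mono (m≤n+m (s * 2) 2) c))
      ... | inj₂ (inj₂ c) = inj₂ (inj₂ (Covered-mono (m≤n+m (s * 2) 2) c))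
      ... | inj₁ M with Step.extend-or-cover M room
      ...   | inj₁ M′       = inj₁ M′
      ...   | inj₂ (inj₁ c) = inj₂ (inj₁ (Covered-mono (m≤n+m (s * 2) 2) c))
      ...   | inj₂ (inj₂ c) = inj₂ (inj₂ (Covered-mono (m≤n+m (s * 2) 2) c))

-- Sums and the cells of the grid

sum-mono : ∀ {n} (f g : Fin n → ℕ) → (∀ i → f i ≤ g i) → sum f ≤ sum g
sum-mono {zero}  f g h = z≤n
sum-mono {suc n} f g h = +-mono-≤ (h zero) (sum-mono (f ∘ suc) (g ∘ suc) (h ∘ suc))

sum-const : ∀ n c → sum {n} (λ _ → c) ≡ n * c
sum-const zero    c = refl
sum-const (suc n) c = cong (c +_) (sum-const n c)

sum-↑ : ∀ m {n} (f : Fin (m + n) → ℕ) → sum f ≡ sum (λ i → f (i ↑ˡ n)) + sum (λ i → f (m ↑ʳ i))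
sum-↑ zero    f = refl
sum-↑ (suc m) f = trans (cong (f zero +_) (sum-↑ m (f ∘ suc))) (sym (+-assoc (f zero) _ _))

sum-combine : ∀ m {n} (f : Fin (m * n) → ℕ) →
  sum f ≡ sum (λ i → sum (λ j → f (combine {m} {n} i j)))
sum-combine zero    f = refl
sum-combine (suc m) {n} f = trans (sum-↑ n f)
  (cong (sum (λ j → f (j ↑ˡ (m * n))) +_) (sum-combine m (λ i → f (n ↑ʳ i))))

count-tabulate : ∀ {n N} (a : Assignment n) (e : Fin N → Fin n) →
  count a (tabulate e) ≡ sum (bit ∘ a ∘ e)
count-tabulate {N = zero}  a e = refl
count-tabulate {N = suc N} a e = cong (bit (a (e zero)) +_) (count-tabulate a (e ∘ suc))

-- Changing one entry changes the sum by the difference of the entries; the additive form avoids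
-- truncated subtraction.
sum-exchange : ∀ {n} (f g : Fin n → ℕ) j → (∀ i → i ≢ j → f i ≡ g i) → sum f + g j ≡ sum g + f j
sum-exchange f g zero h = begin
  f zero + sum (f ∘ suc) + g zero ≡⟨ cong (λ t → f zero + t + g zero) (sum-cong-≗ λ i → h (suc i) λ ()) ⟩
  f zero + sum (g ∘ suc) + g zero ≡⟨ swap (f zero) _ (g zero) ⟩
  g zero + sum (g ∘ suc) + f zero ∎
  where
  open ≡-Reasoning
  swap : ∀ a b c → a + b + c ≡ c + b + a
  swap = solve-∀
sum-exchange f g (suc j) h = begin
  f zero + sum (f ∘ suc) + g (suc j)   ≡⟨ +-assoc (f zero) _ _ ⟩
  f zero + (sum (f ∘ suc) + g (suc j)) ≡⟨ cong₂ _+_ (h zero λ ())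
    (sum-exchange (f ∘ suc) (g ∘ suc) j λ i i≢ → h (suc i) λ { refl → i≢ refl }) ⟩
  g zero + (sum (g ∘ suc) + f (suc j)) ≡⟨ +-assoc (g zero) _ _ ⟨
  g zero + sum (g ∘ suc) + f (suc j)   ∎
  where open ≡-Reasoning

sum-const-off-pair : ∀ {n} (f : Fin n → ℕ) q {j j′} → j ≢ j′ → (∀ i → i ≢ j → i ≢ j′ → f i ≡ q) →
  sum f + (q + q) ≡ n * q + (f j + f j′)
sum-const-off-pair {n} f q {j} {j′} j≢ off = begin
  sum f + (q + q)          ≡⟨ +-assoc (sum f) q q ⟨
  sum f + q + q            ≡⟨ cong (_+ q) first ⟩
  sum h + f j + q          ≡⟨ swap (sum h) (f j) q ⟩
  sum h + q + f j          ≡⟨ cong (_+ f j) second ⟩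
  n * q + f j′ + f j       ≡⟨ +-assoc (n * q) _ _ ⟩
  n * q + (f j′ + f j)     ≡⟨ cong (n * q +_) (+-comm (f j′) (f j)) ⟩
  n * q + (f j + f j′)     ∎
  where
  open ≡-Reasoning
  -- The two exceptional entries are replaced by `q` one after the other; `h` is the intermediate
  -- stage.
  h = updateAt f j (λ _ → q)
  swap : ∀ a b c → a + b + c ≡ a + c + b
  swap = solve-∀
  first : sum f + q ≡ sum h + f j
  first = trans (cong (sum f +_) (sym (updateAt-updates j f)))
            (sum-exchange f h j λ i i≢ → sym (updateAt-minimal i j f i≢))
  h-off : ∀ i → i ≢ j′ → h i ≡ q
  h-off i i≢ with i ≟ j
  ... | yes refl = updateAt-updates j f
  ... | no i≢j   = trans (updateAt-minimal i j f i≢j) (off i i≢j i≢)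
  second : sum h + q ≡ n * q + f j′
  second = trans (sum-exchange h (λ _ → q) j′ h-off)
             (cong₂ _+_ (sum-const n q) (updateAt-minimal j′ j f (j≢ ∘ sym)))

-- Marks the first `N` true positions of `f`; the choice depends only on `f` and `N`.
pick : ∀ {M} → (Fin M → Bool) → ℕ → Fin M → Bool
pick f zero    m       = false
pick f (suc N) zero    = f zero
pick f (suc N) (suc m) = if f zero then pick (f ∘ suc) N m else pick (f ∘ suc) (suc N) m

pick-⊆ : ∀ {M} (f : Fin M → Bool) N m → f m ≡ false → pick f N m ≡ false
pick-⊆ f zero    m       e = refl
pick-⊆ f (suc N) zero    e = e
pick-⊆ f (suc N) (suc m) e with f zero
... | true  = pick-⊆ (f ∘ suc) N m e
... | false = pick-⊆ (f ∘ suc) (suc N) m e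

pick-count : ∀ {M} (f : Fin M → Bool) N → N ≤ sum (bit ∘ f) → sum (bit ∘ pick f N) ≡ N
pick-count {M} f zero h = trans (sum-const M 0) (*-zeroʳ M)
pick-count {suc M} f (suc N) h with f zero
... | true  = cong suc (pick-count (f ∘ suc) N (s≤s⁻¹ h))
... | false = pick-count (f ∘ suc) (suc N) h

on : Bool → Bool → Bool
on true  b = b
on false b = not b

node-cover : ∀ {n} (l r : VTree n) x →
  1 ≤ bit (below l x) + (bit (below r x) + bit (not (below (node l r) x)))
node-cover l r x with below l x | below r x
... | true  | _     = s≤s z≤n
... | false | true  = s≤s z≤n
... | false | false = s≤s z≤n

≤-third : ∀ x {a b c} → 3 * x ≤ a + (b + c) → x ≤ a ⊎ x ≤ b ⊎ x ≤ c
≤-third x {a} {b} {c} h with x ≤? a | x ≤? b | x ≤? c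
... | yes p | _ | _ = inj₁ p
... | no _ | yes p | _ = inj₂ (inj₁ p)
... | no _ | no _ | yes p = inj₂ (inj₂ p)
... | no p | no q | no r = ⊥-elim (<⇒≱ (+-mono-< (≰⇒> p) (+-mono-< (≰⇒> q) (≰⇒> r)))
    (subst (_≤ a + (b + c)) (cong (λ t → x + (x + t)) (+-identityʳ x)) h))

-- A vtree node that splits many minors

module Cells (K X : ℕ) where

  -- Three sets that cover the `3 * X` copies of a cell include one with at least `X` of them.
  M = 3 * X
  n = K * (K * M)

  open Grid K

  cell : Fin K → Fin K → Fin M → Fin n
  cell i j m = combine i (combine j m)

  Rich : (Fin n → Bool) → Bool → Fin K → Fin K → Set
  Rich S b i j = X ≤ sum (λ m → bit (on b (S (cell i j m))))

  rich-all : ∀ S b i j → (∀ m → S (cell i j m) ≡ b) → Rich S b i j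
  rich-all S b i j h = ≤-trans (m≤n*m X 3) (≤-reflexive (sym
    (trans (sum-cong-≗ λ m → trans (cong (bit ∘ on b) (h m)) (on-same b))
      (trans (sum-const M 1) (*-identityʳ M)))))
    where
    on-same : ∀ b → bit (on b b) ≡ 1
    on-same true  = refl
    on-same false = refl

  rich-cover : ∀ (S S′ S″ : Fin n → Bool) b b′ b″ →
    (∀ x → 1 ≤ bit (on b (S x)) + (bit (on b′ (S′ x)) + bit (on b″ (S″ x)))) →
    ∀ i j → Rich S b i j ⊎ Rich S′ b′ i j ⊎ Rich S″ b″ i j
  rich-cover S S′ S″ b b′ b″ h i j = ≤-third X (begin
    M                                    ≡⟨ trans (sum-const M 1) (*-identityʳ M) ⟨
    sum {M} (λ _ → 1)                    ≤⟨ sum-mono _ _ (λ m → h (cell i j m)) ⟩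
    sum (λ m → f m + (f′ m + f″ m))      ≡⟨ ∑-distrib-+ f (λ m → f′ m + f″ m) ⟩
    sum f + sum (λ m → f′ m + f″ m)      ≡⟨ cong (sum f +_) (∑-distrib-+ f′ f″) ⟩
    sum f + (sum f′ + sum f″)            ∎)
    where
    open ≤-Reasoning
    f f′ f″ : Fin M → ℕ
    f  m = bit (on b (S (cell i j m)))
    f′ m = bit (on b′ (S′ (cell i j m)))
    f″ m = bit (on b″ (S″ (cell i j m)))

  rich-total : ∀ S i j → Rich S true i j ⊎ Rich S false i j
  -- The two sides are padded to three sets by repeating the second.
  rich-total S i j with rich-cover S S S true false false cover i j
    where
    cover : ∀ x → 1 ≤ bit (S x) + (bit (not (S x)) + bit (not (S x)))
    cover x with S x
    ... | true  = s≤s z≤n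
    ... | false = s≤s z≤n
  ... | inj₁ h        = inj₁ h
  ... | inj₂ (inj₁ h) = inj₂ h
  ... | inj₂ (inj₂ h) = inj₂ h

  module _ (k : ℕ) (room : suc (k * 2 + (k * 2 + k * 2)) < K) (0<X : 0 < X) where

    room′ : k * 2 + (k * 2 + k * 2) < K
    room′ = <⇒≤ room

    SplitMinors : VTree n → Set
    SplitMinors t = Colouring.Minors (Rich (below t)) k

    greedyAt : ∀ t → SplitMinors t ⊎
      Covered (k * 2) (Rich (below t) true) ⊎ Covered (k * 2) (Rich (below t) false)
    greedyAt t = Colouring.Greedy.greedy (Rich (below t)) (λ b i j → X ≤? _) (rich-total (below t)) k
      (≤-trans (m≤m+n _ _) (<⇒≤ room′))

    module _ (τ : VTree n) where

      -- If the search fails at both children, few lines cover the cells rich inside l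
      -- and those rich inside r; as every cell is rich inside l, inside r or outside
      -- node l r, the cells rich outside node l r then cannot be covered by few lines.
      descend : ∀ t p → subAt τ p ≡ just t → Covered (k * 2) (Rich (below t) false) →
        ∃ λ t′ → (∃ λ p → subAt τ p ≡ just t′) × SplitMinors t′
      -- A cell off the row of `y` lies entirely outside the leaf; chosen off the covering lines
      -- too, it contradicts `cov`.
      descend (leaf y) p at (rs , cs , lr , lc , cov)
        with fresh (proj₁ (remQuot (K * M) y) ∷ rs)
               (≤-trans (s≤s (s≤s (≤-trans lr (m≤m+n _ _)))) room)
           | fresh cs (≤-trans (s≤s (≤-trans lc (m≤m+n _ _))) room′)
      ... | i , i∉ | j , j∉ with cov i j (rich-all (below (leaf y)) false i j out)
        where
        out : ∀ m → does (cell i j m ≟ y) ≡ false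
        out m = dec-false (cell i j m ≟ y)
          λ { refl → i∉ (here (sym (cong proj₁ (remQuot-combine {K} {K * M} i (combine j m))))) }
      ...   | inj₁ i∈ = ⊥-elim (i∉ (there i∈))
      ...   | inj₂ j∈ = ⊥-elim (j∉ j∈)
      descend (node l r) p at cov with greedyAt l
      ... | inj₁ M = l , (p ++ L ∷ [] , subAt-++ τ p (L ∷ []) at) , M
      -- Few lines cover the cells rich outside `l`, which is the invariant of the descent for `l`.
      ... | inj₂ (inj₂ cov′) = descend l (p ++ L ∷ []) (subAt-++ τ p (L ∷ []) at) cov′
      ... | inj₂ (inj₁ covˡ) with greedyAt r
      ...   | inj₁ M = r , (p ++ R ∷ [] , subAt-++ τ p (R ∷ []) at) , M
      ...   | inj₂ (inj₂ cov′) = descend r (p ++ R ∷ []) (subAt-++ τ p (R ∷ []) at) cov′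
      ...   | inj₂ (inj₁ covʳ) = ⊥-elim (impossible covˡ covʳ cov)
        where
        impossible : Covered (k * 2) (Rich (below l) true) → Covered (k * 2) (Rich (below r) true) →
          Covered (k * 2) (Rich (below (node l r)) false) → ⊥
        impossible (rs , cs , lr , lc , h) (rs′ , cs′ , lr′ , lc′ , h′) (rs″ , cs″ , lr″ , lc″ , h″)
          with fresh (rs ++ (rs′ ++ rs″)) (≤-<-trans (len rs rs′ rs″ lr lr′ lr″) room′)
             | fresh (cs ++ (cs′ ++ cs″)) (≤-<-trans (len cs cs′ cs″ lc lc′ lc″) room′)
          where
          len : ∀ (xs ys zs : List (Fin K)) → length xs ≤ k * 2 → length ys ≤ k * 2 → length zs ≤ k * 2 →
            length (xs ++ (ys ++ zs)) ≤ k * 2 + (k * 2 + k * 2)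
          len xs ys zs lx ly lz
            rewrite length-++ xs {ys ++ zs} | length-++ ys {zs}
            = +-mono-≤ lx (+-mono-≤ ly lz)
        ... | i , i∉ | j , j∉
          with rich-cover (below l) (below r) (below (node l r)) true true false (node-cover l r) i j
        ...   | inj₁ ρ with h i j ρ
        ...     | inj₁ e = i∉ (∈-++⁺ˡ e)
        ...     | inj₂ e = j∉ (∈-++⁺ˡ e)
        impossible (rs , cs , lr , lc , h) (rs′ , cs′ , lr′ , lc′ , h′) (rs″ , cs″ , lr″ , lc″ , h″)
            | i , i∉ | j , j∉ | inj₂ (inj₁ ρ) with h′ i j ρ
        ...     | inj₁ e = i∉ (∈-++⁺ʳ rs (∈-++⁺ˡ e))
        ...     | inj₂ e = j∉ (∈-++⁺ʳ cs (∈-++⁺ˡ e))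
        impossible (rs , cs , lr , lc , h) (rs′ , cs′ , lr′ , lc′ , h′) (rs″ , cs″ , lr″ , lc″ , h″)
            | i , i∉ | j , j∉ | inj₂ (inj₂ ρ) with h″ i j ρ
        ...     | inj₁ e = i∉ (∈-++⁺ʳ rs (∈-++⁺ʳ rs′ e))
        ...     | inj₂ e = j∉ (∈-++⁺ʳ cs (∈-++⁺ʳ cs′ e))

      -- The descent starts at the root: no variable is outside it and `X` is positive, so no cell
      -- is rich outside and the empty cover works.
      balanced-node : (∀ x → x ∈ leaves τ) → ∃ λ t → (∃ λ p → subAt τ p ≡ just t) × SplitMinors t
      balanced-node all = descend τ [] refl ([] , [] , z≤n , z≤n , λ i j ρ → ⊥-elim (<⇒≱ 0<X
        (≤-trans ρ (≤-reflexive (trans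
          (sum-cong-≗ λ m → cong (bit ∘ not) (below-true τ (cell i j m) (all _)))
          (trans (sum-const M 0) (*-zeroʳ M)))))))

-- The row and column sum system

allTrue⁺ : ∀ {A : Set} (f : A → Bool) xs → (∀ x → f x ≡ true) → allTrue (map f xs) ≡ true
allTrue⁺ f []       h = refl
allTrue⁺ f (x ∷ xs) h = cong₂ _∧_ (h x) (allTrue⁺ f xs h)

allTrue⁻ : ∀ {A : Set} (f : A → Bool) {xs x} → allTrue (map f xs) ≡ true → x ∈ xs → f x ≡ true
allTrue⁻ f e (here refl) = proj₁ (∧-true e)
allTrue⁻ f {y ∷ _} e (there x∈) = allTrue⁻ f (proj₂ (∧-true {f y} e)) x∈

does-≟⁻ : ∀ {a b} → does (a ≟ℕ b) ≡ true → a ≡ b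
does-≟⁻ {a} {b} e with a ≟ℕ b | dec-false (a ≟ℕ b)
... | yes p | _ = p
... | no ¬p | h with () ← trans (sym e) (h ¬p)

-- `funToFin` depends on its argument only pointwise, so equal digits give equal numbers.
finToFun-injective : ∀ {k q} {x x′ : Fin (q ^ k)} →
  (∀ s → finToFun {q} {k} x s ≡ finToFun x′ s) → x ≡ x′
finToFun-injective {k} {q} {x} {x′} h = trans (sym (funToFin-finToFin {k} {q} x))
  (trans (funToFin-cong {k} {q} h) (funToFin-finToFin {k} {q} x′))
  where
  funToFin-cong : ∀ {k q} {f g : Fin k → Fin q} → (∀ s → f s ≡ g s) → funToFin f ≡ funToFin g
  funToFin-cong {zero}  h = refl
  funToFin-cong {suc k} h = cong₂ combine (h zero) (funToFin-cong (h ∘ suc))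

-- Deviations in the minors and their line sums

module Deviation (K Q : ℕ) {k : ℕ} where

  open Grid K

  -- `just (s , b)` marks a line as one of the two lines of the `s`-th minor, `nothing` a line that
  -- meets no minor.
  Label : Set
  Label = Maybe (Fin k × Bool)

  module Labelling (pos : Fin k → Bool → Fin K) (inj : Injective₂ pos) where

    label : Fin K → Label
    label x with any? (λ s → (pos s false ≟ x) ⊎-dec (pos s true ≟ x))
    ... | yes (s , inj₁ _) = just (s , false)
    ... | yes (s , inj₂ _) = just (s , true)
    ... | no _             = nothing

    label-pos : ∀ s b → label (pos s b) ≡ just (s , b)
    label-pos s b with any? (λ s′ → (pos s′ false ≟ pos s b) ⊎-dec (pos s′ true ≟ pos s b))
    ... | yes (s′ , inj₁ e) = cong just (inj e)
    ... | yes (s′ , inj₂ e) = cong just (inj e)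
    label-pos s false | no ¬h = ⊥-elim (¬h (s , inj₁ refl))
    label-pos s true  | no ¬h = ⊥-elim (¬h (s , inj₂ refl))

    label-just : ∀ x {s b} → label x ≡ just (s , b) → x ≡ pos s b
    label-just x e with any? (λ s → (pos s false ≟ x) ⊎-dec (pos s true ≟ x))
    label-just x refl | yes (s , inj₁ h) = sym h
    label-just x refl | yes (s , inj₂ h) = sym h

  shift : Bool → ℕ → ℕ
  shift false v = Q + v
  shift true  v = Q ∸ v

  -- The deviations +y, −y / −y, +y from Q cancel in every row and column of a minor.
  value : (Fin k → ℕ) → Label → Label → ℕ
  value y (just (s , b)) (just (s′ , b′)) = if does (s ≟ s′) then shift (b xor b′) (y s) else Q
  value y (just _) nothing = Q
  value y nothing  _       = Q

  value-same : ∀ y s b b′ → value y (just (s , b)) (just (s , b′)) ≡ shift (b xor b′) (y s)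
  value-same y s b b′ rewrite dec-true (s ≟ s) refl = refl

  value-sym : ∀ y l l′ → value y l l′ ≡ value y l′ l
  value-sym y nothing nothing = refl
  value-sym y nothing (just _) = refl
  value-sym y (just _) nothing = refl
  value-sym y (just (s , b)) (just (s′ , b′)) = go (s ≟ s′)
    where
    go : Dec (s ≡ s′) → value y (just (s , b)) (just (s′ , b′)) ≡ value y (just (s′ , b′)) (just (s , b))
    go (yes refl) rewrite dec-true (s ≟ s) refl = cong (λ c → shift c (y s)) (xor-comm b b′)
    go (no s≢) rewrite dec-false (s ≟ s′) s≢ | dec-false (s′ ≟ s) (s≢ ∘ sym) = refl

  shift-balance : ∀ b {v} → v ≤ Q → shift b v + shift (not b) v ≡ Q + Q
  shift-balance false {v} v≤ = trans (+-assoc Q v _) (cong (Q +_) (m+[n∸m]≡n v≤))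
  shift-balance true  {v} v≤ = trans (+-comm (Q ∸ v) _) (shift-balance false v≤)

  shift-≤ : ∀ b {v} → v ≤ Q → shift b v ≤ 2 * Q
  shift-≤ false v≤ = +-monoʳ-≤ Q (≤-trans v≤ (m≤m+n Q 0))
  shift-≤ true  {v} v≤ = ≤-trans (m∸n≤m Q v) (m≤m+n Q _)

  value-≤ : ∀ y → (∀ s → y s ≤ Q) → ∀ l l′ → value y l l′ ≤ 2 * Q
  value-≤ y y≤ nothing l′ = m≤m+n Q _
  value-≤ y y≤ (just _) nothing = m≤m+n Q _
  value-≤ y y≤ (just (s , b)) (just (s′ , b′)) with does (s ≟ s′)
  ... | true  = shift-≤ (b xor b′) (y≤ s)
  ... | false = m≤m+n Q _

  module Line (pos : Fin k → Bool → Fin K) (inj : Injective₂ pos) where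
    open Labelling pos inj

    -- Along a line of the `s`-th minor only its two cells can deviate from `Q`. The vector `Y j`
    -- varies with the cell, since a mixed assignment takes its cells from two codes.
    line-sum : ∀ (Y : Fin K → Fin k → ℕ) s b →
      sum (λ j → value (Y j) (just (s , b)) (label j)) + (Q + Q) ≡
      K * Q + (shift b (Y (pos s false) s) + shift (not b) (Y (pos s true) s))
    line-sum Y s b = trans (sum-const-off-pair f Q distinct off)
      (cong (K * Q +_) (cong₂ _+_ at-false at-true))
      where
      f : Fin K → ℕ
      f j = value (Y j) (just (s , b)) (label j)

      distinct : pos s false ≢ pos s true
      distinct e with () ← inj e

      off : ∀ j → j ≢ pos s false → j ≢ pos s true → f j ≡ Q
      off j ≢f ≢t with label j in e
      ... | nothing = refl
      ... | just (s′ , b′) with s ≟ s′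
      ...   | no _ = refl
      off j ≢f ≢t | just (s′ , false) | yes refl = ⊥-elim (≢f (label-just j e))
      off j ≢f ≢t | just (s′ , true)  | yes refl = ⊥-elim (≢t (label-just j e))

      xor-true : ∀ b → b xor true ≡ not b
      xor-true true  = refl
      xor-true false = refl

      at-false : f (pos s false) ≡ shift b (Y (pos s false) s)
      at-false rewrite label-pos s false =
        trans (value-same (Y (pos s false)) s b false) (cong (λ c → shift c _) (xor-identityʳ b))

      at-true : f (pos s true) ≡ shift (not b) (Y (pos s true) s)
      at-true rewrite label-pos s true =
        trans (value-same (Y (pos s true)) s b true) (cong (λ c → shift c _) (xor-true b))

    line-sum-uniform : ∀ y → (∀ s → y s ≤ Q) → ∀ l → sum (λ j → value y l (label j)) ≡ K * Q
    line-sum-uniform y y≤ nothing = sum-const K Q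
    line-sum-uniform y y≤ (just (s , b)) = +-cancelʳ-≡ (Q + Q) _ _
      (trans (line-sum (λ _ → y) s b) (cong (K * Q +_) (shift-balance b (y≤ s))))

    -- The line sum leaves `Q + u + (Q ∸ v) ≡ Q + Q`, and `v ≤ Q` makes the subtraction exact, so
    -- `u ≡ v`.
    line-sum-rigid : ∀ (Y : Fin K → Fin k → ℕ) s → Y (pos s true) s ≤ Q →
      sum (λ j → value (Y j) (just (s , false)) (label j)) ≡ K * Q →
      Y (pos s false) s ≡ Y (pos s true) s
    line-sum-rigid Y s v≤ e = +-cancelʳ-≡ (Q ∸ v) u v (trans (+-cancelˡ-≡ Q _ _ (begin
      Q + (u + (Q ∸ v))  ≡⟨ +-assoc Q u (Q ∸ v) ⟨
      Q + u + (Q ∸ v)    ≡⟨ +-cancelˡ-≡ (K * Q) _ _ (trans (sym (line-sum Y s false)) (cong (_+ (Q + Q)) e)) ⟩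
      Q + Q              ∎)) (sym (m+[n∸m]≡n v≤)))
      where
      open ≡-Reasoning
      u = Y (pos s false) s
      v = Y (pos s true) s

module GridSystem (K Q : ℕ) where

  -- Cell counts are `Q` plus or minus at most `Q`, so a rich side needs `2 * Q` copies.
  open Cells K (2 * Q) public
  open Grid K

  row-var col-var : Fin K → Fin (K * M) → Fin n
  row-var i q = combine i q
  -- Here `q` encodes a row and a copy, and the column `j` is inserted between them.
  col-var j q = combine (proj₁ (remQuot {K} M q)) (combine j (proj₂ (remQuot {K} M q)))

  row-var-injective : ∀ i {q q′} → row-var i q ≡ row-var i q′ → q ≡ q′
  row-var-injective i {q} {q′} e = combine-injectiveʳ i q i q′ e

  col-var-injective : ∀ j {q q′} → col-var j q ≡ col-var j q′ → q ≡ q′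
  col-var-injective j {q} {q′} e with combine-injective {K} {K * M} _ _ _ _ e
  ... | e₁ , e₂ = trans (sym (combine-remQuot {K} M q))
        (trans (cong₂ combine e₁ (combine-injectiveʳ j _ j _ e₂)) (combine-remQuot {K} M q′))

  line : Fin K ⊎ Fin K → List (Fin n)
  line (inj₁ i) = tabulate (row-var i)
  line (inj₂ j) = tabulate (col-var j)

  line-unique : ∀ c → Unique (line c)
  line-unique (inj₁ i) = tabulate⁺ (row-var-injective i)
  line-unique (inj₂ j) = tabulate⁺ (col-var-injective j)

  -- The target `K * Q` amounts to an average of `Q` true copies per cell of the line.
  line-constraint : Fin K ⊎ Fin K → Constraint n
  line-constraint c = CardinalityConstraint.cardinality (line c) (K * Q)

  system : System n
  system = record { m = K + K ; con = line-constraint ∘ splitAt K }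

  system-slim : ∀ {w} → 2 + K * Q ≤ w → ∀ c → SlimOBDD (con system c) w
  system-slim w≥ c =
    CardinalityConstraint.cardinality-slim (line (splitAt K c)) (K * Q) (line-unique (splitAt K c)) w≥

  count-row : ∀ a i → count a (line (inj₁ i)) ≡ sum (λ j → sum (λ m → bit (a (cell i j m))))
  count-row a i = trans (count-tabulate a (row-var i)) (sum-combine K _)

  count-col : ∀ a j → count a (line (inj₂ j)) ≡ sum (λ i → sum (λ m → bit (a (cell i j m))))
  count-col a j = trans (count-tabulate a (col-var j)) (trans (sum-combine K _)
    (sum-cong-≗ λ i → sum-cong-≗ λ m → cong (bit ∘ a)
      (cong (λ r → combine (proj₁ r) (combine j (proj₂ r))) (remQuot-combine {K} {M} i m))))

  sat⁺ : ∀ a → (∀ c → count a (line c) ≡ K * Q) → sat system a ≡ true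
  sat⁺ a h = allTrue⁺ _ (allFin (K + K)) λ c →
    dec-true (count a (line (splitAt K c)) ≟ℕ K * Q) (h (splitAt K c))

  sat⁻ : ∀ a → sat system a ≡ true → ∀ c → count a (line c) ≡ K * Q
  sat⁻ a e (inj₁ i) = does-≟⁻ (subst (λ c → rel (line-constraint c) a ≡ true) (splitAt-↑ˡ K i K)
    (allTrue⁻ (λ c → rel (con system c) a) e (∈-allFin (i ↑ˡ K))))
  sat⁻ a e (inj₂ j) = does-≟⁻ (subst (λ c → rel (line-constraint c) a ≡ true) (splitAt-↑ʳ K K j)
    (allTrue⁻ (λ c → rel (con system c) a) e (∈-allFin (K ↑ʳ j))))

  coords : Fin n → Fin K × Fin K × Fin M
  coords x = map₂ (remQuot {K} M) (remQuot {K} (K * M) x)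

  coords-cell : ∀ i j m → coords (cell i j m) ≡ (i , j , m)
  coords-cell i j m = trans (cong (map₂ (remQuot {K} M)) (remQuot-combine {K} {K * M} i (combine j m)))
    (cong (i ,_) (remQuot-combine {K} {M} j m))

  -- The fooling set

  module Fooling {k : ℕ} (S : Fin n → Bool) (Mi : Colouring.Minors (Rich S) k) where

    open Colouring.Minors Mi
    open Deviation K Q {k}
    module Row = Labelling row row-inj
    module Col = Labelling col col-inj
    open Rectangles S using (mix)

    side : Fin K → Fin K → Fin M → Bool
    side i j m = on (colour i j) (S (cell i j m))

    fill : (Fin K → Fin K → ℕ) → Fin K × Fin K × Fin M → Bool
    fill N (i , j , m) = pick (side i j) (N i j) m

    -- All true copies of a cell lie on the side named by its colour.
    assign : (Fin K → Fin K → ℕ) → Assignment n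
    assign N = fill N ∘ coords

    assign-cell : ∀ N i j m → assign N (cell i j m) ≡ pick (side i j) (N i j) m
    assign-cell N i j m = cong (fill N) (coords-cell i j m)

    -- Off the coloured side both assignments are false, and on it the mix reads only one of them.
    -- Each cell thus inherits its whole count from a single assignment.
    assign-mix : ∀ N N′ i j m → mix (assign N) (assign N′) (cell i j m) ≡
      assign (λ i j → if colour i j then N′ i j else N i j) (cell i j m)
    assign-mix N N′ i j m
      rewrite assign-cell N i j m | assign-cell N′ i j m
            | assign-cell (λ i j → if colour i j then N′ i j else N i j) i j m
      with colour i j | S (cell i j m) in e
    ... | true  | true  = refl
    ... | true  | false = trans (pick-⊆ _ (N i j) m e) (sym (pick-⊆ _ (N′ i j) m e))
    ... | false | true  = trans (pick-⊆ _ (N′ i j) m (cong not e)) (sym (pick-⊆ _ (N i j) m (cong not e)))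
    ... | false | false = refl

    cell-count : ∀ N → (∀ i j → N i j ≤ 2 * Q) →
      ∀ i j → sum (λ m → bit (assign N (cell i j m))) ≡ N i j
    cell-count N N≤ i j = trans (sum-cong-≗ λ m → cong bit (assign-cell N i j m))
      (pick-count (side i j) (N i j) (≤-trans (N≤ i j) (rich-colour i j)))

    table : (Fin K → Fin K → Fin k → ℕ) → Fin K → Fin K → ℕ
    table Y i j = value (Y i j) (Row.label i) (Col.label j)

    table-≤ : ∀ Y → (∀ i j s → Y i j s ≤ Q) → ∀ i j → table Y i j ≤ 2 * Q
    table-≤ Y Y≤ i j = value-≤ (Y i j) (Y≤ i j) (Row.label i) (Col.label j)

    uniform : (Fin k → ℕ) → Fin K → Fin K → ℕ
    uniform y = table λ _ _ → y

    code : (Fin k → ℕ) → Assignment n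
    code y = assign (uniform y)

    code-sat : ∀ y → (∀ s → y s ≤ Q) → sat system (code y) ≡ true
    code-sat y y≤ = sat⁺ _ λ
      { (inj₁ i) → trans (count-row (code y) i)
          (trans (sum-cong-≗ (cell-count (uniform y) bound i))
            (Line.line-sum-uniform col col-inj y y≤ (Row.label i)))
      -- Columns reduce to the argument for rows by the symmetry of `value`.
      ; (inj₂ j) → trans (count-col (code y) j)
          (trans (sum-cong-≗ λ i → trans (cell-count (uniform y) bound i j)
              (value-sym y (Row.label i) (Col.label j)))
            (Line.line-sum-uniform row row-inj y y≤ (Col.label j))) }
      where bound = table-≤ (λ _ _ → y) (λ _ _ → y≤)

    -- On a bichromatic line of the `s`-th minor one of the two deviating cells carries `y s` and
    -- the other `y′ s`. The mix still has the prescribed sum there, so rigidity equates them.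
    code-fooling : ∀ y y′ → (∀ s → y s ≤ Q) → (∀ s → y′ s ≤ Q) →
      sat system (mix (code y) (code y′)) ≡ true → ∀ s → y s ≡ y′ s
    code-fooling y y′ y≤ y′≤ e s = decide (split s)
      where
      Y : Fin K → Fin K → Fin k → ℕ
      Y i j = if colour i j then y′ else y

      Y≤ : ∀ i j s → Y i j s ≤ Q
      Y≤ i j with colour i j
      ... | true  = y′≤
      ... | false = y≤

      push : ∀ i j →
        (if colour i j then uniform y′ i j else uniform y i j) ≡ table Y i j
      push i j with colour i j
      ... | true  = refl
      ... | false = refl

      mixed-cell : ∀ i j → sum (λ m → bit (mix (code y) (code y′) (cell i j m))) ≡ table Y i j
      mixed-cell i j = trans (sum-cong-≗ λ m → cong bit (assign-mix (uniform y) (uniform y′) i j m))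
        (trans (cell-count (λ i j → if colour i j then uniform y′ i j else uniform y i j)
          (λ i j → subst (_≤ 2 * Q) (sym (push i j)) (table-≤ Y Y≤ i j)) i j) (push i j))

      row-eq : ∀ i → sum (λ j → table Y i j) ≡ K * Q
      row-eq i = trans (sum-cong-≗ λ j → sym (mixed-cell i j))
        (trans (sym (count-row _ i)) (sat⁻ _ e (inj₁ i)))

      col-eq : ∀ j → sum (λ i → table Y i j) ≡ K * Q
      col-eq j = trans (sum-cong-≗ λ i → sym (mixed-cell i j))
        (trans (sym (count-col _ j)) (sat⁻ _ e (inj₂ j)))

      unmix : ∀ b b′ → b ≢ b′ → (if b then y′ else y) s ≡ (if b′ then y′ else y) s → y s ≡ y′ s
      unmix true  true  b≢ h = ⊥-elim (b≢ refl)
      unmix true  false b≢ h = sym h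
      unmix false true  b≢ h = h
      unmix false false b≢ h = ⊥-elim (b≢ refl)

      i₀ = row s false
      j₀ = col s false

      decide : colour i₀ j₀ ≢ colour i₀ (col s true) ⊎
        colour i₀ j₀ ≢ colour (row s true) j₀ → y s ≡ y′ s
      decide (inj₁ c≢) = unmix _ _ c≢ (Line.line-sum-rigid col col-inj (Y i₀) s (Y≤ i₀ _ s)
        (trans (sum-cong-≗ λ j → cong (λ l → value (Y i₀ j) l (Col.label j)) (sym (Row.label-pos s false)))
          (row-eq i₀)))
      decide (inj₂ c≢) = unmix _ _ c≢ (Line.line-sum-rigid row row-inj (λ i → Y i j₀) s (Y≤ _ j₀ s)
        (trans (sum-cong-≗ λ i → trans
            (cong (λ l → value (Y i j₀) l (Row.label i)) (sym (Col.label-pos s false)))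
            (value-sym (Y i j₀) (Col.label j₀) (Row.label i)))
          (col-eq j₀)))

  -- Codes of distinct vectors stop at distinct gates: with a common stopping gate their mix would
  -- be accepted, which forces the vectors to be equal.
  size-bound : ∀ k → suc (k * 2 + (k * 2 + k * 2)) < K → 0 < Q →
    ∀ G (D : DSDNNF n G) → DComputes D system → Q ^ k ≤ dsdnnfSize D
  size-bound k room 0<Q G D comp
    with balanced-node k room (≤-trans 0<Q (m≤m+n Q _)) (vtree D) (leavesAll D)
  ... | t , (p , at) , Mi = ≤-trans (injective⇒≤ stop-injective) (gates≤size (circ D))
    where
    open Rectangles (below t)
    open Fooling (below t) Mi
    ok = dsdnnf-respects D p t at

    digits : Fin (Q ^ k) → Fin k → ℕ
    digits x s = toℕ (finToFun {Q} {k} x s)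

    digits≤ : ∀ x s → digits x s ≤ Q
    digits≤ x s = <⇒≤ (toℕ<n (finToFun {Q} {k} x s))

    accepted : ∀ x → output D (code (digits x)) ≡ true
    accepted x = trans (comp _) (code-sat (digits x) (digits≤ x))

    stop-injective : ∀ {x x′} →
      stop (circ D) ok (code (digits x)) zero ≡ stop (circ D) ok (code (digits x′)) zero → x ≡ x′
    stop-injective {x} {x′} e = finToFun-injective {k} {Q} λ s → toℕ-injective
      (code-fooling (digits x) (digits x′) (digits≤ x) (digits≤ x′)
        (trans (sym (comp _)) (mix-sat (circ D) ok _ _ zero (accepted x) (accepted x′) e)) s)

-- Choice of the parameters

^-squared : ∀ k {a b} → a ≤ b → (a * b) ^ k ≤ (b ^ k) ^ 2
^-squared k {a} {b} a≤b = begin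
  (a * b) ^ k  ≤⟨ ^-monoˡ-≤ k (≤-trans (*-monoˡ-≤ b a≤b)
                    (≤-reflexive (cong (b *_) (sym (*-identityʳ b))))) ⟩
  (b ^ 2) ^ k  ≡⟨ ^-*-assoc b 2 k ⟩
  b ^ (2 * k)  ≡⟨ cong (b ^_) (*-comm 2 k) ⟩
  b ^ (k * 2)  ≡⟨ ^-*-assoc b k 2 ⟨
  (b ^ k) ^ 2  ∎
  where open ≤-Reasoning

-- K = 8k leaves a fresh line besides three covers by 2k lines and one further line;
-- Q ≥ 384k gives n / k = 384kQ ≤ Q².
theorem5 : Σ ℕ λ C₁ → Σ ℕ λ C₂ → Σ ℕ λ C₃ →
    (k : ℕ) → .{{_ : NonZero k}} → (N : ℕ) →
    Σ ℕ λ n → N ≤ n × Σ (System n) λ F →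
    IncidenceTreewidth≤ F (C₁ * k)
    × (∀ (G : ℕ) (D : DSDNNF n G) → DComputes D F → (n / k) ^ k ≤ dsdnnfSize D ^ C₂)
    × (∀ (i : Fin (m F)) → SlimOBDD (con F i) (C₃ * n * k))
theorem5 = 16 , 2 , 2 , λ { k@(suc l) N → construction k l refl N }
  where
  -- Here `k` stays a variable, so products with it do not unfold; its positivity enters through
  -- `k ≡ suc l`.
  construction : (k : ℕ) → .{{_ : NonZero k}} → ∀ l → k ≡ suc l → (N : ℕ) →
    Σ ℕ λ n → N ≤ n × Σ (System n) λ F →
    IncidenceTreewidth≤ F (16 * k)
    × (∀ (G : ℕ) (D : DSDNNF n G) → DComputes D F → (n / k) ^ k ≤ dsdnnfSize D ^ 2)
    × (∀ (i : Fin (m F)) → SlimOBDD (con F i) (2 * n * k))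
  construction k l k≡ N = n , N≤n , system
    , Star.star-decomposition system (≤-reflexive (sym (*-distribʳ-+ k 8 8)))
    , (λ G D comp → begin
        (n / k) ^ k          ≡⟨ cong (_^ k) (trans (cong (_/ k) (n-as-multiple k Q))
                                  (m*n/n≡m (384 * k * Q) k)) ⟩
        (384 * k * Q) ^ k    ≤⟨ ^-squared k (m≤m+n (384 * k) N) ⟩
        (Q ^ k) ^ 2          ≤⟨ ^-monoˡ-≤ 2 (size-bound k room 0<Q G D comp) ⟩
        dsdnnfSize D ^ 2     ∎)
    , system-slim slim
    where
    open ≤-Reasoning
    K = 8 * k
    -- The factor 384 is 8 * 8 * 6, from `8 * k` rows, `8 * k` columns and `6 * Q` copies per cell;
    -- the summand `N` makes `n` as large as required.
    Q = 384 * k + N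
    open GridSystem K Q

    n-as-multiple : ∀ k Q → 8 * k * (8 * k * (3 * (2 * Q))) ≡ 384 * k * Q * k
    n-as-multiple = solve-∀

    0<k : 0 < k
    0<k = subst (0 <_) (sym k≡) (s≤s z≤n)

    0<Q : 0 < Q
    0<Q = ≤-trans 0<k (≤-trans (m≤n*m k 384) (m≤m+n (384 * k) N))

    room : suc (k * 2 + (k * 2 + k * 2)) < K
    -- For positive `k`, 6k + 2 is at most 8k.
    room = subst (λ k → suc (k * 2 + (k * 2 + k * 2)) < 8 * k) (sym k≡)
      (≤-trans (m≤m+n _ (2 * l)) (≤-reflexive (slack l)))
      where
      slack : ∀ l → 2 + (suc l * 2 + (suc l * 2 + suc l * 2)) + 2 * l ≡ 8 * suc l
      slack = solve-∀

    n-as-square : ∀ K Q → K * (K * (3 * (2 * Q))) ≡ K * (6 * (K * Q))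
    n-as-square = solve-∀

    0<K : 0 < K
    0<K = ≤-trans 0<k (m≤n*m k 8)

    6KQ≤n : 6 * (K * Q) ≤ n
    6KQ≤n = ≤-trans (m≤n*m (6 * (K * Q)) K {{>-nonZero 0<K}}) (≤-reflexive (sym (n-as-square K Q)))

    N≤n : N ≤ n
    N≤n = begin
      N             ≤⟨ m≤n+m N (384 * k) ⟩
      Q             ≤⟨ m≤n*m Q K {{>-nonZero 0<K}} ⟩
      K * Q         ≤⟨ m≤n*m (K * Q) 6 ⟩
      6 * (K * Q)   ≤⟨ 6KQ≤n ⟩
      n             ∎

    slim : 2 + K * Q ≤ 2 * n * k
    slim = begin
      -- The summand 2 is absorbed because `K * Q` is positive.
      2 + K * Q                 ≤⟨ +-monoˡ-≤ (K * Q) (*-monoʳ-≤ 2 (*-mono-≤ 0<K 0<Q)) ⟩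
      2 * (K * Q) + K * Q       ≤⟨ +-monoʳ-≤ (2 * (K * Q)) (m≤n*m (K * Q) 4) ⟩
      2 * (K * Q) + 4 * (K * Q) ≡⟨ *-distribʳ-+ (K * Q) 2 4 ⟨
      6 * (K * Q)               ≤⟨ 6KQ≤n ⟩
      n                         ≤⟨ m≤n*m n 2 ⟩
      2 * n                     ≤⟨ m≤m*n (2 * n) k ⟩
      2 * n * k                 ∎
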